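{- Let $s$ and $t$ be states in a divergence-free pLTS $\langle S,\mathsf{Act}_\tau,\rightarrow\rangle$ and let $\Theta\in\mathcal D(S)$. Then: 1. $s\sim t$ iff $\overline{s}\equiv^\mu_{\sim}\overline{t}$ iff $\overline{s}\equiv_{\sim}\overline{t}$. 2. $s\prec t$ iff $\overline{s}\sqsubseteq^\mu_{\prec}\overline{t}$ iff $\overline{s}\sqsubseteq_{\prec}\overline{t}$. 3. $s\approx t$ iff $\overline{s}\equiv^\mu_{\approx}\overline{t}$ iff $\overline{s}\equiv_{\approx}\overline{t}$. 4. $s\precsim t$ iff $\overline{s}\sqsubseteq^\mu_{\precsim}\overline{t}$ iff $\overline{s}\sqsubseteq_{\precsim}\overline{t}$. 5. $s\lhd_S\Theta$ iff $\overline{s}\sqsubseteq^\mu_{\lhd_S}\Theta$ iff $\overline{s}\sqsubseteq_{\lhd_S}\Theta$. 6. $s\lhd_{FS}\Theta$ iff $\overline{s}\sqsubseteq^\mu_{\lhd_{FS}}\Theta$ iff $\overline{s}\sqsubseteq_{\lhd_{FS}}\Theta$.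
   Context: Distributions. For a set $S$, $\mathcal D(S)$ is the set of discrete probability distributions $\Delta:S\to[0,1]$, $\sum_{s}\Delta(s)=1$; the support is $\lceil\Delta\rceil=\{s\mid\Delta(s)>0\}$; $\overline{s}$ is the point distribution at $s$; $\sum_{i\in I}p_i\cdot\Delta_i$ (with $p_i\ge0$, $\sum_{i\in I} p_i=1$) is the pointwise convex combination. pLTS. A (finite-state) probabilistic labelled transition system is a triple $\langle S,\mathsf{Act}_\tau,\rightarrow\rangle$ with $S$ a finite set of states, $\mathsf{Act}_\tau=\mathsf{Act}\cup\{\tau\}$ a set of external actions $\mathsf{Act}$ augmented with an internal action $\tau\notin\mathsf{Act}$, and $\rightarrow\ \subseteq S\times\mathsf{Act}_\tau\times\mathcal D(S)$. Write $s\xrightarrow{a}\Delta$ for $(s,a,\Delta)\in\rightarrow$, and $s\not\xrightarrow{a}$ if there is no $\Delta$ with $s\xrightarrow{a}\Delta$. For $A\subseteq\mathsf{Act}$, $s\not\xrightarrow{A}$ means $s\not\xrightarrow{a}$ for all $a\in A\cup\{\tau\}$, and $\Delta\not\xrightarrow{A}$ means $s\not\xrightarrow{A}$ for all $s\in\lceil\Delta\rceil$. A divergence is an infinite sequence of states $s_i$ and distributions $\Delta_i$ with $s_i\xrightarrow{\tau}\Delta_i$ and $s_{i+1}\in\lceil\Delta_i\rceil$ for all $i\ge0$; a pLTS is divergence-free if it has no divergence. Lifting. For $\mathcal R\subseteq S\times S$, $\Delta\mathrel{\mathcal R^\dagger}\Theta$ holds iff there are a countable index set $I$, $p_i\geq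 0$ with $\sum_{i\in I}p_i=1$, and states $s_i,t_i$ with $s_i\mathrel{\mathcal R}t_i$ for all $i\in I$, $\Delta=\sum_{i\in I} p_i\cdot\overline{s_i}$ and $\Theta=\sum_{i\in I} p_i\cdot\overline{t_i}$. For $\mathcal R\subseteq S\times\mathcal D(S)$, $\Delta\mathrel{\mathcal R^\dagger}\Theta$ holds iff there are a countable $I$, $p_i\geq 0$ with $\sum_{i\in I}p_i=1$, states $s_i$ and distributions $\Theta_i$ with $s_i\mathrel{\mathcal R}\Theta_i$ for all $i\in I$, $\Delta=\sum_{i\in I} p_i\cdot\overline{s_i}$ and $\Theta=\sum_{i\in I} p_i\cdot\Theta_i$. Transitions between distributions. $\Delta\xrightarrow{a}\Theta$ denotes the lifting of $\xrightarrow{a}\ \subseteq S\times\mathcal D(S)$. Write $s\xrightarrow{\hat\tau}\Delta$ if $s\xrightarrow{\tau}\Delta$ or $\Delta=\overline{s}$, and $s\xrightarrow{\hat a}\Delta$ iff $s\xrightarrow{a}\Delta$ for $a\in\mathsf{Act}$; $\Delta\xrightarrow{\hat a}\Theta$ denotes the lifting of $\xrightarrow{\hat a}$. The weak transition relation $\stackrel{\hat\tau}{\Longrightarrow}$ on $\mathcal D(S)$ is the reflexive and transitive closure of $\xrightarrow{\hat\tau}$ on $\mathcal D(S)$, and for $a\in\mathsf{Act}$, $\Delta\stackrel{\hat a}{\Longrightarrow}\Theta$ iff there are $\Delta_1,\Delta_2$ with $\Delta\stackrel{\hat\tau}{\Longrightarrow}\Delta_1\xrightarrow{\hat a}\Delta_2\stackrel{\hat\tau}{\Longrightarrow}\Theta$.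 Behavioural relations. $\mathcal R\subseteq S\times S$ is a strong (resp. weak) probabilistic simulation if $s\mathrel{\mathcal R}t$, $a\in\mathsf{Act}_\tau$ and $s\xrightarrow{a}\Delta$ imply that there is some $\Theta$ with $\overline{t}\xrightarrow{a}\Theta$ (resp. $\overline{t}\stackrel{\hat a}{\Longrightarrow}\Theta$) and $\Delta\mathrel{\mathcal R^\dagger}\Theta$. $\mathcal R$ is a strong (resp. weak) probabilistic bisimulation if both $\mathcal R$ and $\mathcal R^{ -1}$ are strong (resp. weak) probabilistic simulations. $s\prec t$, $s\sim t$, $s\precsim t$, $s\approx t$ hold iff $s\mathrel{\mathcal R}t$ for some strong probabilistic simulation, strong probabilistic bisimulation, weak probabilistic simulation, weak probabilistic bisimulation $\mathcal R$, respectively. $\mathcal R\subseteq S\times\mathcal D(S)$ is a failure simulation if $s\mathrel{\mathcal R}\Theta$ implies: (1) if $s\xrightarrow{a}\Delta$ with $a\in\mathsf{Act}_\tau$ then there is $\Theta'$ with $\Theta\stackrel{\hat a}{\Longrightarrow}\Theta'$ and $\Delta\mathrel{\mathcal R^\dagger}\Theta'$; (2) if $s\not\xrightarrow{A}$ with $A\subseteq\mathsf{Act}$ then there is $\Theta'$ with $\Theta\stackrel{\hat\tau}{\Longrightarrow}\Theta'$ and $\Theta'\not\xrightarrow{A}$. A forward simulation is defined by clause (1) only. $s\lhd_{FS}\Theta$ (resp. $s\lhd_S\Theta$) iff $s\mathrel{\mathcal R}\Theta$ for some failure (resp. forward) simulation $\mathcal R$. The logic. $\mathsf{Var}$ is a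 countable set of variables. The class $\mathcal L$ (probabilistic modal mu-calculus) consists of the formulae generated by $$\phi:=\bigwedge_{i\in I}\phi_i\mid\bigvee_{i\in I}\phi_i\mid\neg\phi\mid\langle a\rangle\phi\mid[a]\phi\mid\bigoplus_{i\in I}\phi_i\mid\bigoplus_{i\in I}p_i\cdot\phi_i\mid{\downarrow}\phi\mid X\mid\mu X.\phi\mid\nu X.\phi$$ where $I$ is an (arbitrary) index set, $a\in\mathsf{Act}_\tau$, $\sum_{i\in I}p_i=1$ ($p_i\ge0$), $X\in\mathsf{Var}$, and in $\mu X.\phi$, $\nu X.\phi$ the variable $X$ occurs in $\phi$ only within the scope of an even number of negations. $\mu X,\nu X$ bind $X$; a formula is closed if it has no free variables. For an environment $\rho:\mathsf{Var}\to\mathcal P(\mathcal D(S))$, $\rho[X\mapsto V]$ maps $X$ to $V$ and agrees with $\rho$ elsewhere. Semantics: $[\![\bigwedge_{i\in I}\phi_i]\!]_\rho=\bigcap_{i\in I}[\![\phi_i]\!]_\rho$ ($=\mathcal D(S)$ if $I=\emptyset$); $[\![\bigvee_{i\in I}\phi_i]\!]_\rho=\bigcup_{i\in I}[\![\phi_i]\!]_\rho$; $[\![\neg\phi]\!]_\rho=\mathcal D(S)\setminus[\![\phi]\!]_\rho$; $[\![\bigoplus_{i\in I}\phi_i]\!]_\rho=\{\Delta\mid\Delta=\sum_{i\in I}p_i\cdot\Delta_i\text{ for some }p_i\ge0\text{ with }\sum_{i\in I}p_i=1\text{, and }\Delta_i\in[\![\phi_i]\!]_\rho\text{ for all }i\in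 I\}$; $[\![\bigoplus_{i\in I}p_i\cdot\phi_i]\!]_\rho=\{\Delta\mid\Delta=\sum_{i\in I}p_i\cdot\Delta_i\text{ with }\Delta_i\in[\![\phi_i]\!]_\rho\text{ for all }i\in I\}$; $[\![{\downarrow}\phi]\!]_\rho=\{\Delta\mid\forall s\in\lceil\Delta\rceil:\overline{s}\in[\![\phi]\!]_\rho\}$; $[\![X]\!]_\rho=\rho(X)$; $[\![\mu X.\phi]\!]_\rho=\bigcap\{V\subseteq\mathcal D(S)\mid[\![\phi]\!]_{\rho[X\mapsto V]}\subseteq V\}$; $[\![\nu X.\phi]\!]_\rho=\bigcup\{V\subseteq\mathcal D(S)\mid[\![\phi]\!]_{\rho[X\mapsto V]}\supseteq V\}$. In the strong semantics $[\![\langle a\rangle\phi]\!]_\rho=\{\Delta\mid\exists\Delta':\Delta\xrightarrow{a}\Delta'\wedge\Delta'\in[\![\phi]\!]_\rho\}$ and $[\![[a]\phi]\!]_\rho=\{\Delta\mid\forall\Delta':\Delta\xrightarrow{a}\Delta'\Rightarrow\Delta'\in[\![\phi]\!]_\rho\}$; in the weak semantics $\xrightarrow{a}$ is replaced by $\stackrel{\hat a}{\Longrightarrow}$ in these two clauses. For closed $\phi$, $[\![\phi]\!]$ denotes $[\![\phi]\!]_\rho$ for arbitrary $\rho$. The additional modality $\mathbf{ref}(A)$, $A\subseteq\mathsf{Act}$, has semantics $[\![\mathbf{ref}(A)]\!]_\rho=\{\Delta\mid\exists\Delta':\Delta\stackrel{\hat\tau}{\Longrightarrow}\Delta'\wedge\Delta'\not\xrightarrow{A}\}$.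 Fragments. $\mathcal L^\mu_{\sim}$ is $\mathcal L$ with the strong semantics; $\mathcal L^\mu_{\prec}$ is its fragment without the modalities $\neg$ and $[a]$. $\mathcal L^\mu_{\approx}$ and $\mathcal L^\mu_{\precsim}$ are defined likewise but with the weak semantics. $\mathcal L^\mu_{\lhd_S}$ is the fragment of $\mathcal L^\mu_{\precsim}$ without ${\downarrow}$, and $\mathcal L^\mu_{\lhd_{FS}}$ is obtained from $\mathcal L^\mu_{\lhd_S}$ by adding the modality $\mathbf{ref}(A)$. Dropping the superscript $\mu$ denotes the subclass without variables and fixpoint operators. For $\mathcal R\in\{\sim,\prec,\approx,\precsim,\lhd_S,\lhd_{FS}\}$, $\Delta\sqsubseteq^\mu_{\mathcal R}\Theta$ iff $\Delta\in[\![\phi]\!]\Rightarrow\Theta\in[\![\phi]\!]$ for all closed $\phi\in\mathcal L^\mu_{\mathcal R}$, and $\Delta\sqsubseteq_{\mathcal R}\Theta$ iff $\Delta\in[\![\phi]\!]\Rightarrow\Theta\in[\![\phi]\!]$ for all $\phi\in\mathcal L_{\mathcal R}$. For $\mathcal R\in\{\sim,\approx\}$ these relations are symmetric (because of negation) and are written $\equiv^\mu_{\mathcal R}$ and $\equiv_{\mathcal R}$. -}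

module Defs where

open import Level using (0ℓ; Lift) renaming (suc to lsuc)
open import Algebra.Bundles using (CommutativeRing)
open import Algebra.Core using (Op₁; Op₂)
open import Algebra.Structures using (IsCommutativeRing)
import Algebra.Properties.Ring as RingProperties
open import Data.Bool.Base using (Bool; T; if_then_else_)
open import Data.Empty using (⊥)
open import Data.Fin.Base using (Fin; zero; suc)
open import Data.List.Base as List using (List)
open import Data.List.Relation.Unary.Unique.Propositional using (Unique)
open import Data.Nat.Base as ℕ using (ℕ)
open import Data.Nat.Properties using (_≟_)
open import Data.Parity.Base using (Parity; 0ℙ; 1ℙ; _⁻¹)
open import Data.Product.Base using (_×_; _,_; ∃; ∃-syntax; Σ-syntax)
open import Data.Sum.Base using (_⊎_; inj₁; inj₂)
open import Data.Unit.Base using (⊤)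
open import Data.Vec.Base as Vec using (Vec; lookup; replicate; _[_]≔_)
open import Data.Vec.Properties using (lookup-replicate)
open import Function.Base using (_∘_; flip)
open import Function.Bundles using (_↣_)
open import Relation.Binary.Core using (Rel; REL)
open import Relation.Binary.Construct.Closure.ReflexiveTransitive using (Star)
open import Relation.Binary.PropositionalEquality
  using (_≡_; _≢_; refl; sym; trans; cong; subst)
open import Relation.Binary.Structures using (IsTotalOrder)
open import Relation.Nullary.Decidable.Core using (does)
open import Relation.Nullary.Negation.Core using (¬_)
open import Relation.Unary using (Pred; _⊆_)

-- Subsets as characteristic functions. With excluded middle every predicate
-- arises from one, and 𝒫 X lives in the universe of X: this is what allows
-- environments to range over the very sets that the least and greatest
-- fixpoint clauses quantify over.

𝒫 : ∀ {ℓ} → Set ℓ → Set ℓ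
𝒫 X = X → Bool

infix 4 _∈_

_∈_ : ∀ {ℓ} {X : Set ℓ} → X → 𝒫 X → Set
x ∈ V = T (V x)

-- The real numbers, given by their axioms: a Dedekind-complete ordered field
-- is determined up to isomorphism. Equality is _≡_, so distributions over
-- finite sets (below) also have _≡_ as their equality.

record CompleteOrderedField : Set₁ where
  infix  8 -_
  infixl 7 _*_
  infixl 6 _+_
  infix  4 _≤_ _<_
  field
    Carrier           : Set
    _≤_               : Rel Carrier 0ℓ
    _+_ _*_           : Op₂ Carrier
    -_                : Op₁ Carrier
    0# 1#             : Carrier
    isCommutativeRing : IsCommutativeRing _≡_ _+_ _*_ -_ 0# 1#
    isTotalOrder      : IsTotalOrder _≡_ _≤_
    0≢1               : 0# ≢ 1#
    inverse           : ∀ x → x ≢ 0# → ∃[ y ] x * y ≡ 1#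
    +-monoˡ-≤         : ∀ z {x y} → x ≤ y → x + z ≤ y + z
    *-nonneg          : ∀ {x y} → 0# ≤ x → 0# ≤ y → 0# ≤ x * y

  UpperBound : Pred Carrier 0ℓ → Pred Carrier 0ℓ
  UpperBound P b = ∀ x → P x → x ≤ b

  IsSup : Pred Carrier 0ℓ → Pred Carrier 0ℓ
  IsSup P b = UpperBound P b × (∀ c → UpperBound P c → b ≤ c)

  field
    complete : ∀ (P : Pred Carrier 0ℓ) → ∃ P → ∃ (UpperBound P) → ∃ (IsSup P)

  _<_ : Rel Carrier 0ℓ
  x < y = x ≤ y × x ≢ y

  commutativeRing : CommutativeRing 0ℓ 0ℓ
  commutativeRing = record { isCommutativeRing = isCommutativeRing }

  open CommutativeRing commutativeRing public
    using (ring; +-identityˡ; +-identityʳ; *-identityʳ; -‿inverseʳ)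
  open IsTotalOrder isTotalOrder public
    using (total) renaming (refl to ≤-refl)

  0≤1 : 0# ≤ 1#
  0≤1 with total 0# 1#
  ... | inj₁ 0≤1 = 0≤1
  ... | inj₂ 1≤0 = subst (0# ≤_) -1*-1≡1 (*-nonneg 0≤-1 0≤-1)
    where
    open RingProperties ring using (-1*x≈-x; -‿involutive)
    0≤-1 : 0# ≤ - 1#
    0≤-1 = subst (_≤ - 1#) (-‿inverseʳ 1#)
             (subst (1# + - 1# ≤_) (+-identityˡ (- 1#)) (+-monoˡ-≤ (- 1#) 1≤0))
    -1*-1≡1 : - 1# * - 1# ≡ 1#
    -1*-1≡1 = trans (-1*x≈-x (- 1#)) (-‿involutive 1#)

module Distributions (ℝ : CompleteOrderedField) where

  open CompleteOrderedField ℝ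

  sum : ∀ {n} → Vec Carrier n → Carrier
  sum = Vec.foldr′ _+_ 0#

  -- Distributions over an n-element set; that probabilities are at most 1
  -- follows. The proofs are irrelevant, so that distributions with equal
  -- probabilities are equal.

  record Dist (n : ℕ) : Set where
    constructor mkDist
    field
      probs   : Vec Carrier n
      .nonneg : ∀ s → 0# ≤ lookup probs s
      .total1 : sum probs ≡ 1#

    infix 9 _at_
    _at_ : Fin n → Carrier
    _at_ s = lookup probs s

  open Dist public using (probs; _at_)

  infix 4 _∈⌈_⌉

  _∈⌈_⌉ : ∀ {n} → Fin n → Dist n → Set
  s ∈⌈ Δ ⌉ = 0# < Δ at s

  sum-0 : ∀ n → sum (replicate n 0#) ≡ 0#
  sum-0 ℕ.zero    = refl
  sum-0 (ℕ.suc n) = trans (+-identityˡ _) (sum-0 n)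

  sum-point : ∀ {n} (s : Fin n) → sum (replicate n 0# [ s ]≔ 1#) ≡ 1#
  sum-point {ℕ.suc n} zero    = trans (cong (1# +_) (sum-0 n)) (+-identityʳ 1#)
  sum-point {ℕ.suc n} (suc s) = trans (+-identityˡ _) (sum-point s)

  nonneg-point : ∀ {n} (s t : Fin n) → 0# ≤ lookup (replicate n 0# [ s ]≔ 1#) t
  nonneg-point zero    zero    = 0≤1
  nonneg-point {ℕ.suc n} zero (suc t) = subst (0# ≤_) (sym (lookup-replicate t 0#)) ≤-refl
  nonneg-point (suc s) zero    = ≤-refl
  nonneg-point (suc s) (suc t) = nonneg-point s t

  point : ∀ {n} → Fin n → Dist n
  point {n} s = mkDist (replicate n 0# [ s ]≔ 1#) (nonneg-point s) (sum-point s)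

  -- The sum of a family of nonnegative reals over an arbitrary index set:
  -- the supremum of its finite partial sums.

  IsSum : {I : Set} → (I → Carrier) → Carrier → Set
  IsSum {I} f = IsSup λ x → Σ[ is ∈ List I ] Unique is × x ≡ List.foldr _+_ 0# (List.map f is)

  IsWeighting : {I : Set} → (I → Carrier) → Set
  IsWeighting p = (∀ i → 0# ≤ p i) × IsSum p 1#

  -- Δ = ∑ᵢ pᵢ · Δᵢ, pointwise.

  infix 4 _≡∑_·_

  _≡∑_·_ : ∀ {n} {I : Set} → Dist n → (I → Carrier) → (I → Dist n) → Set
  Δ ≡∑ p · Δs = ∀ s → IsSum (λ i → p i * Δs i at s) (Δ at s)

data Actτ (Act : Set) : Set where
  τ   : Actτ Act
  act : Act → Actτ Act

record PLTS (ℝ : CompleteOrderedField) : Set₁ where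
  open Distributions ℝ
  field
    size : ℕ
    Act  : Set
    step : Fin size → Actτ Act → Dist size → Set

module Processes (ℝ : CompleteOrderedField) (P : PLTS ℝ) where

  open CompleteOrderedField ℝ using (Carrier)
  open Distributions ℝ renaming (Dist to DistOver) public
  open PLTS P public

  State : Set
  State = Fin size

  Dist : Set
  Dist = DistOver size

  infix 4 _—[_]→_ _—[_]↛ _—[_]↛ᴰ

  _—[_]→_ : State → Actτ Act → Dist → Set
  _—[_]→_ = step

  _—[_]↛ : State → 𝒫 Act → Set
  s —[ A ]↛ = ¬ (∃[ Δ ] s —[ τ ]→ Δ) × (∀ a → a ∈ A → ¬ (∃[ Δ ] s —[ act a ]→ Δ))

  _—[_]↛ᴰ : Dist → 𝒫 Act → Set
  Δ —[ A ]↛ᴰ = ∀ s → s ∈⌈ Δ ⌉ → s —[ A ]↛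

  Divergence : Set
  Divergence = Σ[ s ∈ (ℕ → State) ] Σ[ Δ ∈ (ℕ → Dist) ]
    (∀ i → s i —[ τ ]→ Δ i × s (ℕ.suc i) ∈⌈ Δ i ⌉)

  DivergenceFree : Set
  DivergenceFree = ¬ Divergence

  -- Liftings to distributions of relations between states (†ˢ) and of
  -- relations between states and distributions (†ᴰ). "Countable" is finite or
  -- countably infinite.

  record _†ˢ (R : Rel State 0ℓ) (Δ Θ : Dist) : Set₁ where
    field
      I           : Set
      countable   : I ↣ ℕ
      p           : I → Carrier
      isWeighting : IsWeighting p
      s t         : I → State
      related     : ∀ i → R (s i) (t i)
      Δ≡          : Δ ≡∑ p · (point ∘ s)
      Θ≡          : Θ ≡∑ p · (point ∘ t)

  record _†ᴰ (R : REL State Dist 0ℓ) (Δ Θ : Dist) : Set₁ where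
    field
      I           : Set
      countable   : I ↣ ℕ
      p           : I → Carrier
      isWeighting : IsWeighting p
      s           : I → State
      Θs          : I → Dist
      related     : ∀ i → R (s i) (Θs i)
      Δ≡          : Δ ≡∑ p · (point ∘ s)
      Θ≡          : Θ ≡∑ p · Θs

  infix 4 _—[_]→̂_ _—[_]→ᴰ_ _—[_]→̂ᴰ_ _=[_]⇒_

  _—[_]→ᴰ_ : Dist → Actτ Act → Dist → Set₁
  Δ —[ a ]→ᴰ Θ = ((λ s Φ → s —[ a ]→ Φ) †ᴰ) Δ Θ

  _—[_]→̂_ : State → Actτ Act → Dist → Set
  s —[ τ     ]→̂ Δ = s —[ τ ]→ Δ ⊎ Δ ≡ point s
  s —[ act a ]→̂ Δ = s —[ act a ]→ Δ

  _—[_]→̂ᴰ_ : Dist → Actτ Act → Dist → Set₁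
  Δ —[ a ]→̂ᴰ Θ = ((λ s Φ → s —[ a ]→̂ Φ) †ᴰ) Δ Θ

  _=[_]⇒_ : Dist → Actτ Act → Dist → Set₁
  Δ =[ τ     ]⇒ Θ = Star (λ Δ₁ Δ₂ → Δ₁ —[ τ ]→̂ᴰ Δ₂) Δ Θ
  Δ =[ act a ]⇒ Θ = ∃[ Δ₁ ] ∃[ Δ₂ ]
    (Δ =[ τ ]⇒ Δ₁ × Δ₁ —[ act a ]→̂ᴰ Δ₂ × Δ₂ =[ τ ]⇒ Θ)

  data Semantics : Set where
    strong weak : Semantics

  move : Semantics → Dist → Actτ Act → Dist → Set₁
  move strong = _—[_]→ᴰ_
  move weak   = _=[_]⇒_

  IsSimulation : Semantics → Rel State 0ℓ → Set₁
  IsSimulation m R = ∀ {s t} → R s t → ∀ a {Δ} → s —[ a ]→ Δ →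
    ∃[ Θ ] (move m (point t) a Θ × (R †ˢ) Δ Θ)

  IsBisimulation : Semantics → Rel State 0ℓ → Set₁
  IsBisimulation m R = IsSimulation m R × IsSimulation m (flip R)

  infix 4 _∼_ _≺_ _≈_ _≾_ _◁S_ _◁FS_

  _∼_ _≺_ _≈_ _≾_ : State → State → Set₁
  s ∼ t = ∃[ R ] (IsBisimulation strong R × R s t)
  s ≺ t = ∃[ R ] (IsSimulation   strong R × R s t)
  s ≈ t = ∃[ R ] (IsBisimulation weak   R × R s t)
  s ≾ t = ∃[ R ] (IsSimulation   weak   R × R s t)

  IsForwardSimulation : REL State Dist 0ℓ → Set₁
  IsForwardSimulation R = ∀ {s Θ} → R s Θ → ∀ a {Δ} → s —[ a ]→ Δ →
    ∃[ Θ′ ] (Θ =[ a ]⇒ Θ′ × (R †ᴰ) Δ Θ′)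

  IsFailureSimulation : REL State Dist 0ℓ → Set₁
  IsFailureSimulation R = IsForwardSimulation R ×
    (∀ {s Θ} → R s Θ → ∀ A → s —[ A ]↛ → ∃[ Θ′ ] (Θ =[ τ ]⇒ Θ′ × Θ′ —[ A ]↛ᴰ))

  _◁S_ _◁FS_ : State → Dist → Set₁
  s ◁S  Θ = ∃[ R ] (IsForwardSimulation R × R s Θ)
  s ◁FS Θ = ∃[ R ] (IsFailureSimulation R × R s Θ)

  Var : Set
  Var = ℕ

  -- All modalities together; the positivity condition on fixpoint formulae and
  -- the restrictions to particular logics are imposed by _∈𝓛μ_ below.

  data Formula : Set₁ where
    ⋀ ⋁ ⨁ : (I : Set) → (I → Formula) → Formula
    ⨁[_∣_] : {I : Set} (p : I → Carrier) → IsWeighting p → (I → Formula) → Formula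
    ¬′_     : Formula → Formula
    ⟨_⟩_    : Actτ Act → Formula → Formula
    [_]_    : Actτ Act → Formula → Formula
    ↓_      : Formula → Formula
    var     : Var → Formula
    μ ν     : Var → Formula → Formula
    ref     : 𝒫 Act → Formula

  Env : Set
  Env = Var → 𝒫 Dist

  _[_↦_] : Env → Var → 𝒫 Dist → Env
  (ρ [ X ↦ V ]) Y = if does (Y ≟ X) then V else ρ Y

  ⟦_⟧ : Formula → Semantics → Env → Pred Dist (lsuc 0ℓ)
  ⟦ ⋀ I φ ⟧ m ρ Δ          = ∀ i → ⟦ φ i ⟧ m ρ Δ
  ⟦ ⋁ I φ ⟧ m ρ Δ          = ∃[ i ] ⟦ φ i ⟧ m ρ Δ
  ⟦ ⨁ I φ ⟧ m ρ Δ          = ∃[ p ] (IsWeighting p ×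
    (Σ[ Δs ∈ (I → Dist) ] (Δ ≡∑ p · Δs × (∀ i → ⟦ φ i ⟧ m ρ (Δs i)))))
  ⟦ ⨁[_∣_] {I} p _ φ ⟧ m ρ Δ =
    Σ[ Δs ∈ (I → Dist) ] (Δ ≡∑ p · Δs × (∀ i → ⟦ φ i ⟧ m ρ (Δs i)))
  ⟦ ¬′ φ ⟧ m ρ Δ           = ¬ ⟦ φ ⟧ m ρ Δ
  ⟦ ⟨ a ⟩ φ ⟧ m ρ Δ        = ∃[ Δ′ ] (move m Δ a Δ′ × ⟦ φ ⟧ m ρ Δ′)
  ⟦ [ a ] φ ⟧ m ρ Δ        = ∀ Δ′ → move m Δ a Δ′ → ⟦ φ ⟧ m ρ Δ′
  ⟦ ↓ φ ⟧ m ρ Δ            = ∀ s → s ∈⌈ Δ ⌉ → ⟦ φ ⟧ m ρ (point s)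
  ⟦ var X ⟧ m ρ Δ          = Lift (lsuc 0ℓ) (Δ ∈ ρ X)
  ⟦ μ X φ ⟧ m ρ Δ          = ∀ (V : 𝒫 Dist) → ⟦ φ ⟧ m (ρ [ X ↦ V ]) ⊆ (_∈ V) → Δ ∈ V
  ⟦ ν X φ ⟧ m ρ Δ          = Σ[ V ∈ 𝒫 Dist ] ((_∈ V) ⊆ ⟦ φ ⟧ m (ρ [ X ↦ V ]) × Δ ∈ V)
  ⟦ ref A ⟧ m ρ Δ          = ∃[ Δ′ ] (Δ =[ τ ]⇒ Δ′ × Δ′ —[ A ]↛ᴰ)

  -- X has a free occurrence in φ in the scope of a number of negations of
  -- parity q.

  Occurs : Var → Parity → Formula → Set
  Occurs X q (⋀ I φ)        = ∃[ i ] Occurs X q (φ i)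
  Occurs X q (⋁ I φ)        = ∃[ i ] Occurs X q (φ i)
  Occurs X q (⨁ I φ)        = ∃[ i ] Occurs X q (φ i)
  Occurs X q (⨁[ p ∣ _ ] φ) = ∃[ i ] Occurs X q (φ i)
  Occurs X q (¬′ φ)         = Occurs X (q ⁻¹) φ
  Occurs X q (⟨ a ⟩ φ)      = Occurs X q φ
  Occurs X q ([ a ] φ)      = Occurs X q φ
  Occurs X q (↓ φ)          = Occurs X q φ
  Occurs X q (var Y)        = X ≡ Y × q ≡ 0ℙ
  Occurs X q (μ Y φ)        = X ≢ Y × Occurs X q φ
  Occurs X q (ν Y φ)        = X ≢ Y × Occurs X q φ
  Occurs X q (ref A)        = ⊥

  Closed : Formula → Set
  Closed φ = ∀ X q → ¬ Occurs X q φ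

  data Logic : Set where
    L∼ L≺ L≈ L≾ L◁S L◁FS : Logic

  semantics : Logic → Semantics
  semantics L∼ = strong
  semantics L≺ = strong
  semantics _  = weak

  HasNegationAndBox : Logic → Set
  HasNegationAndBox L∼ = ⊤
  HasNegationAndBox L≈ = ⊤
  HasNegationAndBox _  = ⊥

  HasDown : Logic → Set
  HasDown L◁S  = ⊥
  HasDown L◁FS = ⊥
  HasDown _    = ⊤

  HasRef : Logic → Set
  HasRef L◁FS = ⊤
  HasRef _    = ⊥

  infix 4 _∈𝓛μ_ _∈𝓛_

  _∈𝓛μ_ : Formula → Logic → Set
  ⋀ I φ        ∈𝓛μ L = ∀ i → φ i ∈𝓛μ L
  ⋁ I φ        ∈𝓛μ L = ∀ i → φ i ∈𝓛μ L
  ⨁ I φ        ∈𝓛μ L = ∀ i → φ i ∈𝓛μ L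
  ⨁[ p ∣ _ ] φ ∈𝓛μ L = ∀ i → φ i ∈𝓛μ L
  ¬′ φ         ∈𝓛μ L = HasNegationAndBox L × φ ∈𝓛μ L
  ⟨ a ⟩ φ      ∈𝓛μ L = φ ∈𝓛μ L
  [ a ] φ      ∈𝓛μ L = HasNegationAndBox L × φ ∈𝓛μ L
  ↓ φ          ∈𝓛μ L = HasDown L × φ ∈𝓛μ L
  var X        ∈𝓛μ L = ⊤
  μ X φ        ∈𝓛μ L = ¬ Occurs X 1ℙ φ × φ ∈𝓛μ L
  ν X φ        ∈𝓛μ L = ¬ Occurs X 1ℙ φ × φ ∈𝓛μ L
  ref A        ∈𝓛μ L = HasRef L

  WithoutFixpoints : Formula → Set
  WithoutFixpoints (⋀ I φ)        = ∀ i → WithoutFixpoints (φ i)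
  WithoutFixpoints (⋁ I φ)        = ∀ i → WithoutFixpoints (φ i)
  WithoutFixpoints (⨁ I φ)        = ∀ i → WithoutFixpoints (φ i)
  WithoutFixpoints (⨁[ p ∣ _ ] φ) = ∀ i → WithoutFixpoints (φ i)
  WithoutFixpoints (¬′ φ)         = WithoutFixpoints φ
  WithoutFixpoints (⟨ a ⟩ φ)      = WithoutFixpoints φ
  WithoutFixpoints ([ a ] φ)      = WithoutFixpoints φ
  WithoutFixpoints (↓ φ)          = WithoutFixpoints φ
  WithoutFixpoints (var X)        = ⊥
  WithoutFixpoints (μ X φ)        = ⊥
  WithoutFixpoints (ν X φ)        = ⊥
  WithoutFixpoints (ref A)        = ⊤

  _∈𝓛_ : Formula → Logic → Set
  φ ∈𝓛 L = WithoutFixpoints φ × φ ∈𝓛μ L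

  infix 4 _⊑μ[_]_ _⊑[_]_ _≡μ[_]_ _≡[_]_

  _⊑μ[_]_ : Dist → Logic → Dist → Set₁
  Δ ⊑μ[ L ] Θ = ∀ φ → φ ∈𝓛μ L → Closed φ →
    ∀ ρ → ⟦ φ ⟧ (semantics L) ρ Δ → ⟦ φ ⟧ (semantics L) ρ Θ

  _⊑[_]_ : Dist → Logic → Dist → Set₁
  Δ ⊑[ L ] Θ = ∀ φ → φ ∈𝓛 L →
    ∀ ρ → ⟦ φ ⟧ (semantics L) ρ Δ → ⟦ φ ⟧ (semantics L) ρ Θ

  -- Alternative notation for L∼ and L≈, where negation makes these relations
  -- symmetric.

  _≡μ[_]_ : Dist → Logic → Dist → Set₁
  _≡μ[_]_ = _⊑μ[_]_

  _≡[_]_ : Dist → Logic → Dist → Set₁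
  _≡[_]_ = _⊑[_]_

{-# OPTIONS --safe #-}
module Submission where

-- Soundness: a relation ⊴ on distributions that is compatible with moves, with
-- decompositions Δ = ∑ᵢ pᵢ · Δᵢ and, where the logic has them, with negation, ↓
-- and ref, carries ⟦ φ ⟧ ρ into ⟦ φ ⟧ ρ′ as soon as it carries ρ X into ρ′ X for
-- the positive X and ρ′ X into ρ X for the negative ones. Allowing ρ ≢ ρ′ makes
-- the fixpoint cases immediate, without a separate monotonicity argument. The
-- liftings R † of reflexive (bi)simulations R are such relations: a lifting is
-- the same thing as a kernel sending each state s to a countable mixture of
-- distributions related to s, so it decomposes along the mixtures on its left.
-- Matching weak moves must be mixed countably, which needs a common bound on
-- the number of their steps; divergence-freeness provides one.
--
-- Completeness: s satisfies the conjunction φₛ of formulae that separate it from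
-- every distribution not above it. If s —[ a ]→ Δ, then s satisfies
-- ⟨ a ⟩ ⨁ᵤ Δ(u) · φᵤ (with ↓ φᵤ in place of φᵤ when the relation is between
-- states), and this formula of a distribution above s gives the matching move.

open import Defs
open import Axiom.ExcludedMiddle using (ExcludedMiddle)
open import Level using (Lift; lift; 0ℓ; _⊔_) renaming (suc to lsuc)
open import Algebra.Bundles using (CommutativeRing)
import Algebra.Properties.Ring as RingProperties
open import Data.Bool.Base using (T; true; false)
open import Data.Bool.Properties using (T-irrelevant)
open import Data.Fin.Base using (Fin; zero; suc)
open import Data.Fin.Properties using (toℕ-injective)
open import Data.List.Base as List using (List; []; _∷_; _++_; map; deduplicate; allFin)
open import Data.List.Membership.Propositional using () renaming (_∈_ to _∈ˡ_)
open import Data.List.Membership.Propositional.Properties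
  using (∈-allFin; ∈-deduplicate⁺; ∈-map⁺; ∈-map⁻; ∈-++⁻)
open import Data.List.Properties using (map-∘)
open import Data.List.Relation.Unary.All as All using (All; []; _∷_)
open import Data.List.Relation.Unary.AllPairs using ([]; _∷_)
open import Data.List.Relation.Unary.Any using (here; there)
open import Data.List.Relation.Unary.Unique.Propositional using (Unique)
open import Data.List.Relation.Unary.Unique.Propositional.Properties as Unique using (++⁺)
open import Data.List.Relation.Unary.Unique.DecPropositional.Properties using (deduplicate-!)
open import Data.Nat.Base as ℕ using (ℕ)
import Data.Nat.Properties as ℕₚ
open import Data.Parity.Base using (Parity; 0ℙ; 1ℙ; _⁻¹)
open import Data.Product.Base using (Σ; _×_; _,_; proj₁; proj₂; ∃; ∃-syntax; Σ-syntax; uncurry)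
open import Data.Sum.Base as Sum using (_⊎_; inj₁; inj₂)
open import Data.Unit.Base using (⊤; tt)
open import Data.Vec.Base as Vec using (lookup; tabulate; replicate)
open import Data.Vec.Properties
  using ( lookup∘update; lookup∘update′; lookup-replicate
        ; lookup∘tabulate; tabulate∘lookup; tabulate-cong)
open import Function.Base using (_∘_; id; flip)
open import Function.Bundles using (_⇔_; _↣_; mk⇔; mk↣; Injection)
open import Induction.WellFounded using (Acc; acc; WellFounded)
open import Relation.Binary.Construct.Closure.ReflexiveTransitive using (ε; _◅_; _◅◅_)
open import Relation.Binary.Definitions using (tri<; tri≈; tri>)
open import Relation.Binary.PropositionalEquality hiding ([_])
open import Relation.Binary.Structures using (IsTotalOrder)
open import Relation.Nullary.Decidable.Core using (Dec; yes; no; does; recompute; decidable-stable)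
open import Relation.Nullary.Negation.Core using (¬_; contradiction)

-- Ordered-field arithmetic and sums over arbitrary index sets.

module Sums (em : ∀ ℓ → ExcludedMiddle ℓ) (ℝ : CompleteOrderedField) where

  open CompleteOrderedField ℝ
  open CommutativeRing commutativeRing
    using (+-comm; +-assoc; *-comm; *-assoc; distribˡ; zeroˡ; zeroʳ; *-identityˡ; -‿inverseˡ)
  open IsTotalOrder isTotalOrder
    using () renaming (trans to ≤-trans; antisym to ≤-antisym; reflexive to ≤-reflexive)
  open Distributions ℝ renaming (sum to vsum)

  dec : ∀ {ℓ} (A : Set ℓ) → Dec A
  dec A = em _

  -- Excluded middle brings a predicate of any level down to the universe of `A`. The sets chosen
  -- for fixpoints in the soundness proof and the relation `Above` in the completeness proof rely on
  -- this drop.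
  ⌊_⌋ : ∀ {a b} {A : Set a} → (A → Set b) → 𝒫 A
  ⌊ Q ⌋ x = does (dec (Q x))

  module _ {a b} {A : Set a} {Q : A → Set b} where

    ∈⌊⌋⁺ : ∀ {x} → Q x → x ∈ ⌊ Q ⌋
    ∈⌊⌋⁺ {x} q with dec (Q x)
    ... | yes _ = tt
    ... | no ¬q = contradiction q ¬q

    ∈⌊⌋⁻ : ∀ {x} → x ∈ ⌊ Q ⌋ → Q x
    ∈⌊⌋⁻ {x} x∈ with dec (Q x)
    ... | yes q = q

  +-mono-≤ : ∀ {a b c d} → a ≤ b → c ≤ d → a + c ≤ b + d
  +-mono-≤ {a} {b} {c} {d} a≤b c≤d = ≤-trans (+-monoˡ-≤ c a≤b)
    (subst₂ _≤_ (+-comm c b) (+-comm d b) (+-monoˡ-≤ b c≤d))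

  a+b-b≡a : ∀ a b → (a + b) + - b ≡ a
  a+b-b≡a a b = trans (+-assoc a b (- b)) (trans (cong (a +_) (-‿inverseʳ b)) (+-identityʳ a))

  a-b+b≡a : ∀ a b → (a + - b) + b ≡ a
  a-b+b≡a a b = trans (+-assoc a (- b) b) (trans (cong (a +_) (-‿inverseˡ b)) (+-identityʳ a))

  a+b≤c⇒a≤c-b : ∀ {a b c} → a + b ≤ c → a ≤ c + - b
  a+b≤c⇒a≤c-b {a} {b} h = subst (_≤ _) (a+b-b≡a a b) (+-monoˡ-≤ (- b) h)

  a≤c-b⇒a+b≤c : ∀ {a b c} → a ≤ c + - b → a + b ≤ c
  a≤c-b⇒a+b≤c {a} {b} {c} h = subst (_ ≤_) (a-b+b≡a c b) (+-monoˡ-≤ b h)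

  *-monoˡ-≤ : ∀ {c x y} → 0# ≤ c → x ≤ y → c * x ≤ c * y
  *-monoˡ-≤ {c} {x} {y} 0≤c x≤y = subst₂ _≤_ (+-identityˡ (c * x))
    (trans (sym (distribˡ c (y + - x) x)) (cong (c *_) (a-b+b≡a y x)))
    (+-monoˡ-≤ (c * x) (*-nonneg 0≤c (a+b≤c⇒a≤c-b (subst (_≤ y) (sym (+-identityˡ x)) x≤y))))

  *-≤ʳ : ∀ {c x} → 0# ≤ c → x ≤ 1# → c * x ≤ c
  *-≤ʳ {c} {x} 0≤c x≤1 = subst (c * x ≤_) (*-identityʳ c) (*-monoˡ-≤ 0≤c x≤1)

  inverse-nonneg : ∀ {x y} → 0# ≤ x → x * y ≡ 1# → 0# ≤ y
  inverse-nonneg {x} {y} 0≤x xy≡1 with total 0# y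
  ... | inj₁ 0≤y = 0≤y
  ... | inj₂ y≤0 = contradiction
    (≤-antisym 0≤1 (subst₂ _≤_ xy≡1 (zeroʳ x) (*-monoˡ-≤ 0≤x y≤0))) 0≢1

  *-≢0 : ∀ {x y} → x ≢ 0# → y ≢ 0# → x * y ≢ 0#
  *-≢0 {x} {y} x≢0 y≢0 xy≡0 with d , xd≡1 ← inverse x x≢0 = y≢0
    (trans (sym (*-identityˡ y)) (trans (cong (_* y) (trans (sym xd≡1) (*-comm x d)))
      (trans (*-assoc d x y) (trans (cong (d *_) xy≡0) (zeroʳ d)))))

  psum : {I : Set} → (I → Carrier) → List I → Carrier
  psum f is = List.foldr _+_ 0# (map f is)

  NonNeg : {I : Set} → (I → Carrier) → Set
  NonNeg f = ∀ i → 0# ≤ f i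

  PartialSum≤ : {I : Set} → (I → Carrier) → Carrier → Set
  PartialSum≤ {I} f c = ∀ (is : List I) → Unique is → psum f is ≤ c

  module _ {I : Set} {f : I → Carrier} where

    isSum : ∀ {x} → PartialSum≤ f x → (∀ c → PartialSum≤ f c → x ≤ c) → IsSum f x
    isSum ub least =
      (λ { _ (is , u , refl) → ub is u }) , (λ c h → least c (λ is u → h _ (is , u , refl)))

    partialSum≤ : ∀ {x} → IsSum f x → PartialSum≤ f x
    partialSum≤ s is u = proj₁ s _ (is , u , refl)

    sum≤ : ∀ {x c} → IsSum f x → PartialSum≤ f c → x ≤ c
    sum≤ s h = proj₂ s _ (λ { _ (is , u , refl) → h is u })

    IsSum-unique : ∀ {x y} → IsSum f x → IsSum f y → x ≡ y
    IsSum-unique s s′ = ≤-antisym (sum≤ s (partialSum≤ s′)) (sum≤ s′ (partialSum≤ s))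

    IsSum-exists : ∀ {c} → PartialSum≤ f c → ∃ (IsSum f)
    IsSum-exists {c} h = complete _ (0# , [] , [] , refl) (c , λ { _ (is , u , refl) → h is u })

    term≤ : ∀ {x} → IsSum f x → ∀ i → f i ≤ x
    term≤ s i = subst (_≤ _) (+-identityʳ (f i)) (partialSum≤ s (i ∷ []) ([] ∷ []))

    sum-nonneg : ∀ {x} → IsSum f x → 0# ≤ x
    sum-nonneg s = partialSum≤ s [] []

    psum-0 : (∀ i → f i ≡ 0#) → ∀ is → psum f is ≡ 0#
    psum-0 f≡0 []       = refl
    psum-0 f≡0 (i ∷ is) = trans (cong₂ _+_ (f≡0 i) (psum-0 f≡0 is)) (+-identityˡ 0#)

    IsSum-0 : (∀ i → f i ≡ 0#) → IsSum f 0#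
    IsSum-0 f≡0 = isSum (λ is _ → ≤-reflexive (psum-0 f≡0 is)) (λ c h → h [] [])

    psum-++ : ∀ is js → psum f (is ++ js) ≡ psum f is + psum f js
    psum-++ []       js = sym (+-identityˡ _)
    psum-++ (i ∷ is) js = trans (cong (f i +_) (psum-++ is js)) (sym (+-assoc (f i) _ _))

  module _ {I : Set} {f g : I → Carrier} where

    psum-cong : (∀ i → f i ≡ g i) → ∀ is → psum f is ≡ psum g is
    psum-cong f≗g []       = refl
    psum-cong f≗g (i ∷ is) = cong₂ _+_ (f≗g i) (psum-cong f≗g is)

    IsSum-cong : ∀ {x y} → (∀ i → f i ≡ g i) → x ≡ y → IsSum f x → IsSum g y
    IsSum-cong f≗g refl s = isSum
      (λ is u → subst (_≤ _) (psum-cong f≗g is) (partialSum≤ s is u))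
      (λ c h → sum≤ s (λ is u → subst (_≤ c) (sym (psum-cong f≗g is)) (h is u)))

    psum-mono : (∀ i → f i ≤ g i) → ∀ is → psum f is ≤ psum g is
    psum-mono f≤g []       = ≤-refl
    psum-mono f≤g (i ∷ is) = +-mono-≤ (f≤g i) (psum-mono f≤g is)

  module _ {I : Set} {f : I → Carrier} where

    psum-* : ∀ c is → psum (λ i → c * f i) is ≡ c * psum f is
    psum-* c []       = sym (zeroʳ c)
    psum-* c (i ∷ is) = trans (cong (c * f i +_) (psum-* c is)) (sym (distribˡ c (f i) _))

    -- For leastness, an upper bound of the scaled partial sums is divided by `c`, hence the
    -- separate case of `c ≡ 0#`.
    IsSum-* : ∀ {c x} → 0# ≤ c → IsSum f x → IsSum (λ i → c * f i) (c * x)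
    IsSum-* {c} {x} 0≤c s with dec (c ≡ 0#)
    ... | yes refl =
      IsSum-cong (λ i → sym (zeroˡ (f i))) (sym (zeroˡ x)) (IsSum-0 {f = λ _ → 0#} (λ _ → refl))
    ... | no c≢0 with d , cd≡1 ← inverse c c≢0 = isSum
      (λ is u → subst (_≤ c * x) (sym (psum-* c is)) (*-monoˡ-≤ 0≤c (partialSum≤ s is u)))
      (λ b h → subst (c * x ≤_) (cancel b) (*-monoˡ-≤ 0≤c (sum≤ s (λ is u →
        subst (_≤ d * b) (trans (cong (d *_) (psum-* c is)) (cancel′ (psum f is)))
          (*-monoˡ-≤ (inverse-nonneg 0≤c cd≡1) (h is u))))))
      where
      cancel : ∀ b → c * (d * b) ≡ b
      cancel b = trans (sym (*-assoc c d b)) (trans (cong (_* b) cd≡1) (*-identityˡ b))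
      cancel′ : ∀ b → d * (c * b) ≡ b
      cancel′ b = trans (sym (*-assoc d c b))
        (trans (cong (_* b) (trans (*-comm d c) cd≡1)) (*-identityˡ b))

  module _ {A B : Set} (e : A → B) (e-injective : ∀ {x y} → e x ≡ e y → x ≡ y)
    {f : B → Carrier} (support : ∀ b → (∃[ a ] e a ≡ b) ⊎ f b ≡ 0#) where

    -- Indices outside the image of `e` contribute 0 and are dropped. The membership clause is what
    -- keeps `as` free of repetitions in the induction.
    pull : ∀ bs → Unique bs →
      ∃[ as ] (Unique as × (∀ {a} → a ∈ˡ as → e a ∈ˡ bs) × psum (f ∘ e) as ≡ psum f bs)
    pull [] _ = [] , [] , (λ ()) , refl
    pull (b ∷ bs) (b∉ ∷ u) with pull bs u | support b
    ... | as , u′ , as⊆ , eq | inj₂ fb≡0 =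
      as , u′ , there ∘ as⊆ , trans eq (trans (sym (+-identityˡ _)) (cong (_+ psum f bs) (sym fb≡0)))
    ... | as , u′ , as⊆ , eq | inj₁ (a , refl) =
      a ∷ as
      , All.tabulate (λ a′∈ a≡a′ → All.lookup b∉ (as⊆ a′∈) (cong e a≡a′)) ∷ u′
      , (λ { (here refl) → here refl ; (there a′∈) → there (as⊆ a′∈) })
      , cong (f b +_) eq

    psum-map : ∀ as → psum f (map e as) ≡ psum (f ∘ e) as
    psum-map as = cong (List.foldr _+_ 0#) (sym (map-∘ as))

    partialSum≤-restrict : ∀ {c} → PartialSum≤ f c → PartialSum≤ (f ∘ e) c
    partialSum≤-restrict h as u =
      subst (_≤ _) (psum-map as) (h (map e as) (Unique.map⁺ e-injective u))

    partialSum≤-extend : ∀ {c} → PartialSum≤ (f ∘ e) c → PartialSum≤ f c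
    partialSum≤-extend h bs u with as , u′ , _ , eq ← pull bs u = subst (_≤ _) eq (h as u′)

    IsSum-restrict : ∀ {x} → IsSum f x → IsSum (f ∘ e) x
    IsSum-restrict s = isSum (partialSum≤-restrict (partialSum≤ s))
      (λ c h → sum≤ s (partialSum≤-extend h))

    IsSum-extend : ∀ {x} → IsSum (f ∘ e) x → IsSum f x
    IsSum-extend s = isSum (partialSum≤-extend (partialSum≤ s))
      (λ c h → sum≤ s (partialSum≤-restrict h))

  IsSum-⊤ : {f : ⊤ → Carrier} → 0# ≤ f tt → IsSum f (f tt)
  IsSum-⊤ {f} 0≤f = isSum ub (λ c h → subst (_≤ c) (+-identityʳ (f tt)) (h (tt ∷ []) ([] ∷ [])))
    where
    ub : PartialSum≤ f (f tt)
    ub [] _ = 0≤f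
    ub (tt ∷ []) _ = ≤-reflexive (+-identityʳ (f tt))
    ub (tt ∷ tt ∷ _) ((tt≢tt ∷ _) ∷ _) = contradiction refl tt≢tt

  IsSum-single : ∀ {I : Set} {f : I → Carrier} i → 0# ≤ f i → (∀ j → i ≢ j → f j ≡ 0#) → IsSum f (f i)
  IsSum-single {f = f} i 0≤fi f≡0 = IsSum-extend (λ _ → i) (λ _ → refl) support (IsSum-⊤ 0≤fi)
    where
    support : ∀ j → (∃[ _ ] i ≡ j) ⊎ f j ≡ 0#
    support j with dec (i ≡ j)
    ... | yes i≡j = inj₁ (tt , i≡j)
    ... | no  i≢j = inj₂ (f≡0 j i≢j)

  -- Iterated sums of nonnegative families.

  module Fubini {I : Set} {J : I → Set} {f : ∀ i → J i → Carrier} {g : I → Carrier}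
    (inner : ∀ i → IsSum (f i) (g i)) where

    F : Σ I J → Carrier
    F = uncurry f

    record Split (i : I) (ks : List (Σ I J)) : Set where
      field
        js          : List (J i)
        rest        : List (Σ I J)
        js-unique   : Unique js
        rest-unique : Unique rest
        js⊆         : ∀ {j} → j ∈ˡ js → (i , j) ∈ˡ ks
        rest⊆       : ∀ {k} → k ∈ˡ rest → k ∈ˡ ks × i ≢ proj₁ k
        psum≡       : psum F ks ≡ psum (f i) js + psum F rest

    split : ∀ i ks → Unique ks → Split i ks
    split i [] _ = record
      { js = [] ; rest = [] ; js-unique = [] ; rest-unique = []
      ; js⊆ = λ () ; rest⊆ = λ () ; psum≡ = sym (+-identityˡ 0#) }
    split i ((i′ , j) ∷ ks) (k∉ ∷ u) with dec (i ≡ i′) | split i ks u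
    ... | yes refl | s = record
      { js = j ∷ js ; rest = rest
      ; js-unique = All.tabulate (λ j′∈ j≡j′ → All.lookup k∉ (js⊆ j′∈) (cong (i ,_) j≡j′)) ∷ js-unique
      ; rest-unique = rest-unique
      ; js⊆ = λ { (here refl) → here refl ; (there j′∈) → there (js⊆ j′∈) }
      ; rest⊆ = λ k∈ → there (proj₁ (rest⊆ k∈)) , proj₂ (rest⊆ k∈)
      ; psum≡ = trans (cong (f i j +_) psum≡) (sym (+-assoc (f i j) _ _)) }
      where open Split s
    ... | no i≢i′ | s = record
      { js = js ; rest = (i′ , j) ∷ rest
      ; js-unique = js-unique
      ; rest-unique = All.tabulate (λ k∈ → All.lookup k∉ (proj₁ (rest⊆ k∈))) ∷ rest-unique
      ; js⊆ = there ∘ js⊆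
      ; rest⊆ = λ { (here refl) → here refl , i≢i′
                  ; (there k∈) → there (proj₁ (rest⊆ k∈)) , proj₂ (rest⊆ k∈) }
      ; psum≡ = trans (cong (f i′ j +_) psum≡) (x+[y+z]≡y+[x+z] (f i′ j) _ _) }
      where
      open Split s
      x+[y+z]≡y+[x+z] : ∀ x y z → x + (y + z) ≡ y + (x + z)
      x+[y+z]≡y+[x+z] x y z = trans (sym (+-assoc x y z))
        (trans (cong (_+ z) (+-comm x y)) (+-assoc y x z))

    -- The entries of `ks` in row `i` are split off and bounded by `g i`; what is left lies in the
    -- remaining rows.
    psum-covered : ∀ is ks → Unique ks → (∀ {k} → k ∈ˡ ks → proj₁ k ∈ˡ is) → psum F ks ≤ psum g is
    psum-covered [] []       u k⊆ = ≤-refl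
    psum-covered [] (k ∷ ks) u k⊆ with () ← k⊆ (here refl)
    psum-covered (i ∷ is) ks u k⊆ = subst (_≤ _) (sym psum≡)
      (+-mono-≤ (partialSum≤ (inner i) js js-unique) (psum-covered is rest rest-unique rest⊆is))
      where
      open Split (split i ks u)
      rest⊆is : ∀ {k} → k ∈ˡ rest → proj₁ k ∈ˡ is
      rest⊆is k∈ with rest⊆ k∈
      ... | k∈ks , i≢ with k⊆ k∈ks
      ... | here refl = contradiction refl i≢
      ... | there p   = p

    -- The list `ks` accumulates finite pieces of the rows already treated. For row `i` the bound
    -- holds with every finite piece `js` in place of the row, so it survives the passage to the
    -- supremum `g i`.
    psum-iterated : ∀ {c} → PartialSum≤ F c → ∀ is → Unique is →
      ∀ ks → Unique ks → (∀ {k} → k ∈ˡ ks → ¬ proj₁ k ∈ˡ is) → psum g is + psum F ks ≤ c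
    psum-iterated h [] u ks uks disj = subst (_≤ _) (sym (+-identityˡ _)) (h ks uks)
    psum-iterated {c} h (i ∷ is) (i∉ ∷ u) ks uks disj = subst (_≤ c) (sym (+-assoc (g i) _ _))
      (a≤c-b⇒a+b≤c (sum≤ (inner i) (λ js ujs → a+b≤c⇒a≤c-b (subst (_≤ c) (rearrange js)
        (psum-iterated h is u (map (i ,_) js ++ ks) (unique js ujs) (disj′ js))))))
      where
      rearrange : ∀ js → psum g is + psum F (map (i ,_) js ++ ks) ≡
                         psum (f i) js + (psum g is + psum F ks)
      rearrange js = trans (cong (psum g is +_) (trans (psum-++ (map (i ,_) js) ks)
          (cong (_+ psum F ks) (cong (List.foldr _+_ 0#) (sym (map-∘ js))))))
        (trans (sym (+-assoc _ _ _)) (trans (cong (_+ psum F ks) (+-comm _ _)) (+-assoc _ _ _)))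
      unique : ∀ js → Unique js → Unique (map (i ,_) js ++ ks)
      unique js ujs = ++⁺ (Unique.map⁺ (λ { refl → refl }) ujs) uks
        (λ { (k∈ , k∈ks) → disj k∈ks (here (cong proj₁ (proj₂ (proj₂ (∈-map⁻ (i ,_) k∈))))) })
      disj′ : ∀ js {k} → k ∈ˡ map (i ,_) js ++ ks → ¬ proj₁ k ∈ˡ is
      disj′ js k∈ with ∈-++⁻ (map (i ,_) js) k∈
      ... | inj₁ k∈js = λ i∈ → All.lookup i∉ i∈ (sym (cong proj₁ (proj₂ (proj₂ (∈-map⁻ (i ,_) k∈js)))))
      ... | inj₂ k∈ks = disj k∈ks ∘ there

    psum-outer≤ : ∀ {c} → PartialSum≤ F c → PartialSum≤ g c
    psum-outer≤ h is u = subst (_≤ _) (+-identityʳ _) (psum-iterated h is u [] [] (λ ()))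

    join : ∀ {x} → IsSum g x → IsSum F x
    join s = isSum
      (λ ks u → let is = map proj₁ ks in ≤-trans
        -- Several entries of `ks` may lie in one row, so the list of rows is deduplicated before
        -- the sum of `g` can bound it.
        (psum-covered (deduplicate _≟_ is) ks u (∈-deduplicate⁺ _≟_ ∘ ∈-map⁺ proj₁))
        (partialSum≤ s (deduplicate _≟_ is) (deduplicate-! _≟_ is)))
      (λ c h → sum≤ s (psum-outer≤ h))
      where
      _≟_ : (i i′ : I) → Dec (i ≡ i′)
      i ≟ i′ = dec (i ≡ i′)

    -- The row sums have bounded partial sums and hence some sum by completeness of the reals;
    -- `join` and uniqueness identify it with `x`.
    unjoin : ∀ {x} → IsSum F x → IsSum g x
    unjoin {x} s with y , s′ ← IsSum-exists (psum-outer≤ (partialSum≤ s)) =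
      subst (IsSum g) (IsSum-unique (join s′) s) s′

  -- Both iterated sums agree with the sum over all pairs, which is invariant under exchanging the
  -- components.
  IsSum-swap : ∀ {I J : Set} {f : I → J → Carrier} {g : I → Carrier} {h : J → Carrier} {x} →
    (∀ i → IsSum (f i) (g i)) → (∀ j → IsSum (λ i → f i j) (h j)) → IsSum g x → IsSum h x
  IsSum-swap inner inner′ s = Fubini.unjoin inner′
    (IsSum-restrict (λ { (j , i) → i , j }) (λ { refl → refl })
      (λ { (i , j) → inj₁ ((j , i) , refl) }) (Fubini.join inner s))

  -- An instance of `psum-covered` in which every row consists of one cell.
  psum-⊆ : ∀ {I : Set} {f : I → Carrier} → NonNeg f →
    ∀ is js → Unique is → (∀ {i} → i ∈ˡ is → i ∈ˡ js) → psum f is ≤ psum f js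
  psum-⊆ {f = f} f≥0 is js u is⊆js = subst (_≤ psum f js) (cong (List.foldr _+_ 0#) (sym (map-∘ is)))
    (Fubini.psum-covered (λ i → IsSum-⊤ (f≥0 i)) js (map (_, tt) is)
      (Unique.map⁺ (cong proj₁) u) (λ k∈ → covered (∈-map⁻ (_, tt) k∈)))
    where
    covered : ∀ {k} → ∃[ i ] (i ∈ˡ is × k ≡ (i , tt)) → proj₁ k ∈ˡ js
    covered (_ , i∈is , refl) = is⊆js i∈is

  psum-tabulate : ∀ {I : Set} (f : I → Carrier) {n} (h : Fin n → I) →
    psum f (List.tabulate h) ≡ vsum (tabulate (f ∘ h))
  psum-tabulate f {ℕ.zero}  h = refl
  psum-tabulate f {ℕ.suc n} h = cong (f (h zero) +_) (psum-tabulate f (h ∘ suc))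

  IsSum-Fin : ∀ {n} {f : Fin n → Carrier} → NonNeg f → IsSum f (vsum (tabulate f))
  IsSum-Fin {n} {f} f≥0 = isSum
    (λ is u → subst (psum f is ≤_) total-psum (psum-⊆ f≥0 is (allFin n) u (λ {i} _ → ∈-allFin i)))
    (λ c h → subst (_≤ c) total-psum (h (allFin n) (Unique.allFin⁺ n)))
    where
    total-psum : psum f (allFin n) ≡ vsum (tabulate f)
    total-psum = psum-tabulate f id

  -- Distributions, point distributions and mixtures.

  -- The stored proof is irrelevant; deciding the proposition recovers one that can be used.
  at-nonneg : ∀ {n} (Δ : Dist n) → NonNeg (Δ at_)
  at-nonneg (mkDist _ nonneg _) s = recompute (dec _) (nonneg s)

  IsWeighting-at : ∀ {n} (Δ : Dist n) → IsWeighting (Δ at_)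
  IsWeighting-at Δ@(mkDist ps _ total1) = at-nonneg Δ , IsSum-cong (λ _ → refl)
    (trans (cong vsum (tabulate∘lookup ps)) (recompute (dec _) total1)) (IsSum-Fin (at-nonneg Δ))

  Dist-≡ : ∀ {n} {Δ Θ : Dist n} → (∀ s → Δ at s ≡ Θ at s) → Δ ≡ Θ
  Dist-≡ {Δ = mkDist ps _ _} {mkDist qs _ _} h
    with refl ← trans (sym (tabulate∘lookup ps)) (trans (tabulate-cong h) (tabulate∘lookup qs)) = refl

  point-at : ∀ {n} (s : Fin n) → point s at s ≡ 1#
  point-at s = lookup∘update s (replicate _ 0#) 1#

  point-at-≢ : ∀ {n} {s t : Fin n} → t ≢ s → point s at t ≡ 0#
  point-at-≢ {t = t} t≢s = trans (lookup∘update′ t≢s (replicate _ 0#) 1#) (lookup-replicate t 0#)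

  ∈⌈⌉-point : ∀ {n} (s t : Fin n) → t ∈⌈ point s ⌉ → t ≡ s
  ∈⌈⌉-point s t (_ , 0≢) with dec (t ≡ s)
  ... | yes t≡s = t≡s
  ... | no  t≢s = contradiction (sym (point-at-≢ t≢s)) 0≢

  ∉⌈⌉ : ∀ {n} {s : Fin n} (Δ : Dist n) → ¬ s ∈⌈ Δ ⌉ → Δ at s ≡ 0#
  ∉⌈⌉ {s = s} Δ s∉ with dec (0# ≡ Δ at s)
  ... | yes 0≡ = sym 0≡
  ... | no  0≢ = contradiction (at-nonneg Δ s , 0≢) s∉

  module _ {n : ℕ} {I : Set} {p : I → Carrier} (w : IsWeighting p) where

    abstract
      -- Each coordinate is dominated by the sum of the weights and so has a sum; interchanging the
      -- sums over `I` and over states shows that the total mass is 1.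
      mixture : (Δs : I → Dist n) → ∃[ Δ ] Δ ≡∑ p · Δs
      mixture Δs = mkDist (tabulate m)
          (λ s → subst (0# ≤_) (sym (lookup∘tabulate m s)) (m-nonneg s)) sum-m
        , λ s → subst (IsSum _) (sym (lookup∘tabulate m s)) (proj₂ (coordinate s))
        where
        coordinate : ∀ s → ∃ (IsSum (λ i → p i * Δs i at s))
        coordinate s = IsSum-exists {c = 1#} (λ is u → ≤-trans
          (psum-mono (λ i → *-≤ʳ (proj₁ w i) (term≤ (proj₂ (IsWeighting-at (Δs i))) s)) is)
          (partialSum≤ (proj₂ w) is u))
        m : Fin n → Carrier
        m s = proj₁ (coordinate s)
        m-nonneg : NonNeg m
        m-nonneg s = sum-nonneg (proj₂ (coordinate s))
        sum-m : vsum (tabulate m) ≡ 1#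
        sum-m = IsSum-unique (IsSum-Fin m-nonneg) (IsSum-swap
          (λ i → IsSum-* (proj₁ w i) (proj₂ (IsWeighting-at (Δs i))))
          (λ s → proj₂ (coordinate s))
          (IsSum-cong (λ i → sym (*-identityʳ (p i))) refl (proj₂ w)))

    mix-const : (Δ : Dist n) → Δ ≡∑ p · (λ _ → Δ)
    mix-const Δ s = IsSum-cong (λ i → *-comm (Δ at s) (p i)) (*-identityʳ _)
      (IsSum-* (at-nonneg Δ s) (proj₂ w))

  module _ {n : ℕ} {I : Set} {p : I → Carrier} {Δs : I → Dist n} where

    mix-unique : ∀ {Δ Θ} → Δ ≡∑ p · Δs → Θ ≡∑ p · Δs → Δ ≡ Θ
    mix-unique Δ≡ Θ≡ = Dist-≡ (λ s → IsSum-unique (Δ≡ s) (Θ≡ s))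

    -- Allowing arbitrary changes at weight 0 makes it possible to repair components outside a
    -- support.
    mix-cong : ∀ {Δ Θs} → (∀ i → p i ≡ 0# ⊎ Δs i ≡ Θs i) → Δ ≡∑ p · Δs → Δ ≡∑ p · Θs
    mix-cong {Θs = Θs} eq Δ≡ s = IsSum-cong (λ i → term≡ i (eq i)) refl (Δ≡ s)
      where
      term≡ : ∀ i → p i ≡ 0# ⊎ Δs i ≡ Θs i → p i * Δs i at s ≡ p i * Θs i at s
      term≡ i (inj₁ p≡0) = trans (cong (_* Δs i at s) p≡0)
        (trans (zeroˡ _) (sym (trans (cong (_* Θs i at s) p≡0) (zeroˡ _))))
      term≡ i (inj₂ Δ≡Θ) = cong (λ Θ → p i * Θ at s) Δ≡Θ

    ∈⌈⌉-mix : ∀ {Δ s} → Δ ≡∑ p · Δs → s ∈⌈ Δ ⌉ → ∃[ i ] (p i ≢ 0# × Δs i at s ≢ 0#)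
    ∈⌈⌉-mix {Δ} {s} Δ≡ (_ , 0≢) with dec (∃[ i ] (p i ≢ 0# × Δs i at s ≢ 0#))
    ... | yes h = h
    ... | no  h = contradiction (IsSum-unique (IsSum-0 term≡0) (Δ≡ s)) 0≢
      where
      term≡0 : ∀ i → p i * Δs i at s ≡ 0#
      term≡0 i with dec (p i ≡ 0#) | dec (Δs i at s ≡ 0#)
      ... | yes p≡0 | _       = trans (cong (_* Δs i at s) p≡0) (zeroˡ _)
      ... | no  p≢0 | yes Δ≡0 = trans (cong (p i *_) Δ≡0) (zeroʳ _)
      ... | no  p≢0 | no  Δ≢0 = contradiction (i , p≢0 , Δ≢0) h

    module _ {J : I → Set} {q : ∀ i → J i → Carrier} {Δss : ∀ i → J i → Dist n}
      (p≥0 : NonNeg p) where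

      mix-join : ∀ {Δ} → (∀ i → Δs i ≡∑ q i · Δss i) → Δ ≡∑ p · Δs →
        Δ ≡∑ uncurry (λ i j → p i * q i j) · uncurry Δss
      mix-join inner Δ≡ s = IsSum-cong (λ _ → refl) refl (Fubini.join
        (λ i → IsSum-cong (λ j → sym (*-assoc (p i) (q i j) _)) refl (IsSum-* (p≥0 i) (inner i s)))
        (Δ≡ s))

  weighting-join : ∀ {I : Set} {J : I → Set} {p : I → Carrier} {q : ∀ i → J i → Carrier} →
    IsWeighting p → (∀ i → IsWeighting (q i)) → IsWeighting (uncurry (λ i j → p i * q i j))
  weighting-join {p = p} (p≥0 , sum-p) w =
    (λ (i , j) → *-nonneg (p≥0 i) (proj₁ (w i) j)) , Fubini.join
      (λ i → IsSum-cong (λ _ → refl) (*-identityʳ (p i)) (IsSum-* (p≥0 i) (proj₂ (w i)))) sum-p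

  ∈⌈⌉-mix⁺ : ∀ {n} {I : Set} {p : I → Carrier} {Δ Δs} {s : Fin n} → NonNeg p → Δ ≡∑ p · Δs →
    ∀ {i} → p i ≢ 0# → Δs i at s ≢ 0# → s ∈⌈ Δ ⌉
  ∈⌈⌉-mix⁺ {p = p} {Δ} {Δs} {s} p≥0 Δ≡ {i} p≢0 Δi≢0 = at-nonneg Δ s , λ 0≡ →
    *-≢0 p≢0 Δi≢0 (≤-antisym (subst (p i * Δs i at s ≤_) (sym 0≡) (term≤ (Δ≡ s) i))
      (*-nonneg (p≥0 i) (at-nonneg (Δs i) s)))

  mix-points : ∀ {n} (Δ : Dist n) → Δ ≡∑ (Δ at_) · point
  mix-points Δ s = IsSum-cong (λ _ → refl) term≡
    (IsSum-single s (subst (0# ≤_) (sym term≡) (at-nonneg Δ s))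
      (λ t s≢t → trans (cong (Δ at t *_) (point-at-≢ s≢t)) (zeroʳ _)))
    where
    term≡ : Δ at s * point s at s ≡ Δ at s
    term≡ = trans (cong (Δ at s *_) (point-at s)) (*-identityʳ _)

  mix-point : ∀ {n m} s (K : Fin n → Dist m) → K s ≡∑ (point s at_) · K
  mix-point s K u = IsSum-cong (λ _ → refl) term≡
    (IsSum-single s (subst (0# ≤_) (sym term≡) (at-nonneg (K s) u))
      (λ t s≢t → trans (cong (_* K t at u) (point-at-≢ (s≢t ∘ sym))) (zeroˡ _)))
    where
    term≡ : point s at s * K s at u ≡ K s at u
    term≡ = trans (cong (_* K s at u) (point-at s)) (*-identityˡ _)

  -- Linearity of the action of the kernel `K` on distributions, by interchanging the sum over
  -- states with the sum over `I`.
  mix-bind : ∀ {n m} {I : Set} {p : I → Carrier} {Δ Δs Θ Θs} {K : Fin n → Dist m} → NonNeg p →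
    Δ ≡∑ p · Δs → Θ ≡∑ (Δ at_) · K → (∀ i → Θs i ≡∑ (Δs i at_) · K) → Θ ≡∑ p · Θs
  mix-bind {p = p} {Δs = Δs} {K = K} p≥0 Δ≡ Θ≡ Θs≡ u = IsSum-swap
    (λ s → IsSum-cong
      (λ i → trans (*-comm (K s at u) _) (*-assoc (p i) (Δs i at s) (K s at u))) (*-comm _ _)
      (IsSum-* (at-nonneg (K s) u) (Δ≡ s)))
    (λ i → IsSum-* (p≥0 i) (Θs≡ i u))
    (Θ≡ u)

  IsWeighting-⊤ : IsWeighting {⊤} (λ _ → 1#)
  IsWeighting-⊤ = (λ _ → 0≤1) , IsSum-⊤ 0≤1

-- Countability of dependent sums.

-- Countability asks only for an injection, so this code may leave gaps: 3 is not a value.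
pair : ℕ → ℕ → ℕ
pair a b = (a ℕ.+ b) ℕ.* (a ℕ.+ b) ℕ.+ a

-- (a + b)² ≤ pair a b < (a + b + 1)², so pair a b determines a + b.
pair-mono : ∀ a b c d → a ℕ.+ b ℕ.< c ℕ.+ d → pair a b ℕ.< pair c d
pair-mono a b c d n<m = begin-strict
  n ℕ.* n ℕ.+ a             <⟨ ℕ.s≤s (ℕₚ.+-mono-≤ (ℕₚ.*-monoʳ-≤ n (ℕₚ.n≤1+n n)) (ℕₚ.m≤m+n a b)) ⟩
  ℕ.suc (n ℕ.* ℕ.suc n ℕ.+ n) ≡⟨ cong ℕ.suc (ℕₚ.+-comm (n ℕ.* ℕ.suc n) n) ⟩
  ℕ.suc n ℕ.* ℕ.suc n       ≤⟨ ℕₚ.*-mono-≤ n<m n<m ⟩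
  m ℕ.* m                   ≤⟨ ℕₚ.m≤m+n (m ℕ.* m) c ⟩
  m ℕ.* m ℕ.+ c             ∎
  where
  open ℕₚ.≤-Reasoning
  n m : ℕ
  n = a ℕ.+ b
  m = c ℕ.+ d

pair-injective : ∀ {a b c d} → pair a b ≡ pair c d → a ≡ c × b ≡ d
pair-injective {a} {b} {c} {d} eq with ℕₚ.<-cmp (a ℕ.+ b) (c ℕ.+ d)
... | tri< n<m _ _ = contradiction eq (ℕₚ.<⇒≢ (pair-mono a b c d n<m))
... | tri> _ _ m<n = contradiction (sym eq) (ℕₚ.<⇒≢ (pair-mono c d a b m<n))
... | tri≈ _ n≡m _ = a≡c , ℕₚ.+-cancelˡ-≡ c b d (trans (cong (ℕ._+ b) (sym a≡c)) n≡m)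
  where
  a≡c : a ≡ c
  a≡c = ℕₚ.+-cancelˡ-≡ ((c ℕ.+ d) ℕ.* (c ℕ.+ d)) a c (subst (λ n → n ℕ.* n ℕ.+ a ≡ pair c d) n≡m eq)

countable-⊤ : ⊤ ↣ ℕ
countable-⊤ = mk↣ {to = λ _ → 0} (λ _ → refl)

countable-Fin : ∀ {n} → Fin n ↣ ℕ
countable-Fin = mk↣ toℕ-injective

countable-Σ : {I : Set} {J : I → Set} → I ↣ ℕ → (∀ i → J i ↣ ℕ) → Σ I J ↣ ℕ
countable-Σ {I} {J} f g = mk↣ {to = code} injective
  where
  code : Σ I J → ℕ
  code (i , j) = pair (Injection.to f i) (Injection.to (g i) j)
  injective : ∀ {x y} → code x ≡ code y → x ≡ y
  injective {i , j} {i′ , j′} eq with fi≡ , gj≡ ← pair-injective {Injection.to f i} eq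
    with refl ← Injection.injective f fi≡ = cong (i ,_) (Injection.injective (g i) gj≡)

-- Liftings as kernels, and their decomposition.

module Liftings (em : ∀ ℓ → ExcludedMiddle ℓ) (ℝ : CompleteOrderedField) (P : PLTS ℝ) where

  open CompleteOrderedField ℝ
  open CommutativeRing commutativeRing using (*-comm; *-assoc; zeroˡ; zeroʳ; *-identityˡ)
  open IsTotalOrder isTotalOrder using () renaming (antisym to ≤-antisym)
  open Processes ℝ P
  open Sums em ℝ

  -- Mixtures are countable to match the index sets of liftings. A kernel whose value at each `s`
  -- lies in `Hull (R s)` is the second description of a lifting; `†-bind` and `Disintegration` pass
  -- between the two.
  record Hull (C : Dist → Set) (Θ : Dist) : Set₁ where
    field
      I           : Set
      countable   : I ↣ ℕ
      p           : I → Carrier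
      isWeighting : IsWeighting p
      Θs          : I → Dist
      related     : ∀ i → C (Θs i)
      Θ≡          : Θ ≡∑ p · Θs

  hull-single : ∀ {C Θ} → C Θ → Hull C Θ
  hull-single {Θ = Θ} c = record
    { countable = countable-⊤ ; isWeighting = IsWeighting-⊤
    ; related = λ _ → c ; Θ≡ = mix-const IsWeighting-⊤ Θ }

  module _ {R : State → Dist → Set} where

    †-mono : ∀ {Q : State → Dist → Set} {Δ Θ} → (∀ {s Φ} → R s Φ → Q s Φ) → (R †ᴰ) Δ Θ → (Q †ᴰ) Δ Θ
    †-mono R⊆Q r = record { _†ᴰ r ; related = λ i → R⊆Q (_†ᴰ.related r i) }

    hull⇒† : ∀ {s Θ} → Hull (R s) Θ → (R †ᴰ) (point s) Θ
    hull⇒† {s} h = record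
      { countable = countable ; isWeighting = isWeighting ; related = related
      ; Δ≡ = mix-const isWeighting (point s) ; Θ≡ = Θ≡ }
      where open Hull h

    †-point : ∀ {s Θ} → R s Θ → (R †ᴰ) (point s) Θ
    †-point r = hull⇒† (hull-single r)

    abstract
      -- Outer and inner indices are paired and their weights multiplied; countability of `I` keeps
      -- the index set of pairs countable.
      †-mix : ∀ {I : Set} {p : I → Carrier} {Δ Δs Θ Θs} → I ↣ ℕ → IsWeighting p →
        Δ ≡∑ p · Δs → Θ ≡∑ p · Θs → (∀ i → (R †ᴰ) (Δs i) (Θs i)) → (R †ᴰ) Δ Θ
      †-mix {Δ = Δ} {Δs} {Θ} {Θs} c w@(p≥0 , _) Δ≡ Θ≡ r = record
        { countable   = countable-Σ c (λ i → countable (r i))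
        ; isWeighting = weighting-join w (λ i → isWeighting (r i))
        ; related     = uncurry (λ i → related (r i))
        ; Δ≡          = mix-join {Δs = Δs} {Δss = λ i → point ∘ _†ᴰ.s (r i)} p≥0 {Δ}
                          (λ i → _†ᴰ.Δ≡ (r i)) Δ≡
        ; Θ≡          = mix-join {Δs = Θs} {Δss = λ i → _†ᴰ.Θs (r i)} p≥0 {Θ}
                          (λ i → _†ᴰ.Θ≡ (r i)) Θ≡ }
        where open _†ᴰ using (countable; isWeighting; related)

      †-bind : ∀ {Δ Θ} {K : State → Dist} → (∀ s → Hull (R s) (K s)) → Θ ≡∑ (Δ at_) · K → (R †ᴰ) Δ Θ
      †-bind {Δ} {Θ} {K} hull Θ≡ = †-mix {Δs = point} {Θ} {K}
        countable-Fin (IsWeighting-at Δ) (mix-points Δ) Θ≡ (λ s → hull⇒† (hull s))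

    module _ (R-refl : ∀ s → R s (point s)) where

      †-refl : ∀ Δ → (R †ᴰ) Δ Δ
      †-refl Δ = †-bind {Θ = Δ} (λ s → hull-single (R-refl s)) (mix-points Δ)

      module Disintegration {Δ Θ} (r : (R †ᴰ) Δ Θ) where
        open _†ᴰ r

        p≥0 : NonNeg p
        p≥0 = proj₁ isWeighting

        Fibre : State → Set
        Fibre u = Σ[ i ∈ I ] s i ≡ u

        fibre-sum : ∀ u → IsSum {Fibre u} (p ∘ proj₁) (Δ at u)
        fibre-sum u = IsSum-cong
          (λ { (i , refl) → trans (cong (p i *_) (point-at u)) (*-identityʳ (p i)) }) refl
          (IsSum-restrict proj₁ (λ { {_ , refl} {_ , refl} refl → refl }) support (Δ≡ u))
          where
          support : ∀ i → (∃[ x ] proj₁ x ≡ i) ⊎ p i * point (s i) at u ≡ 0#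
          support i with dec (s i ≡ u)
          ... | yes si≡u = inj₁ ((i , si≡u) , refl)
          ... | no  si≢u = inj₂ (trans (cong (p i *_) (point-at-≢ (si≢u ∘ sym))) (zeroʳ (p i)))

        -- `Φ` is the conditional distribution of the right-hand side given the left-hand state `u`.
        -- The field `integral` is its defining equation multiplied by `Δ at u`, which makes sense
        -- at probability 0 too.
        record Conditional (u : State) : Set₁ where
          field
            Φ         : Dist
            hull      : Hull (R u) Φ
            integral  : ∀ v → IsSum {Fibre u} (λ (i , _) → p i * Θs i at v) (Δ at u * Φ at v)

        conditional : ∀ u → Conditional u
        conditional u with dec (0# ≡ Δ at u)
        ... | yes 0≡ = record
          -- Nothing can be conditioned on a state of probability 0; reflexivity of `R` supplies a
          -- value in the hull.
          { Φ = point u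
          ; hull = hull-single (R-refl u)
          ; integral = λ v → IsSum-cong (λ _ → refl)
              (sym (trans (cong (_* _) (sym 0≡)) (zeroˡ _))) (IsSum-0 (term≡0 v)) }
          where
          term≡0 : ∀ v (x : Fibre u) → p (proj₁ x) * Θs (proj₁ x) at v ≡ 0#
          term≡0 v x = trans (cong (_* Θs (proj₁ x) at v) (≤-antisym
            (subst (p (proj₁ x) ≤_) (sym 0≡) (term≤ (fibre-sum u) x)) (p≥0 (proj₁ x)))) (zeroˡ _)
        ... | no 0≢ with d , Δd≡1 ← inverse (Δ at u) (0≢ ∘ sym) = record
          { Φ = proj₁ mix
          ; hull = record
              { I = Fibre u
              ; countable = countable-Σ countable
                  (λ _ → mk↣ {to = λ _ → 0} (λ { {refl} {refl} _ → refl }))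
              ; isWeighting = w
              ; related = λ { (i , refl) → related i }
              ; Θs = Θs ∘ proj₁
              ; Θ≡ = proj₂ mix }
          ; integral = λ v → IsSum-cong (λ x → cancel (p (proj₁ x)) (Θs (proj₁ x) at v)) refl
              (IsSum-* (at-nonneg Δ u) (proj₂ mix v)) }
          where
          d≥0 : 0# ≤ d
          d≥0 = inverse-nonneg (at-nonneg Δ u) Δd≡1
          -- The weights on the fibre sum to `Δ at u`, and `d` is the inverse of that number.
          w : IsWeighting {Fibre u} (λ x → d * p (proj₁ x))
          w = (λ x → *-nonneg d≥0 (p≥0 (proj₁ x)))
            , IsSum-cong (λ _ → refl) (trans (*-comm d _) Δd≡1) (IsSum-* d≥0 (fibre-sum u))
          mix : ∃[ Φ ] Φ ≡∑ (λ x → d * p (proj₁ x)) · (Θs ∘ proj₁)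
          mix = mixture w (Θs ∘ proj₁)
          cancel : ∀ x y → Δ at u * ((d * x) * y) ≡ x * y
          cancel x y = trans (sym (*-assoc _ _ y)) (cong (_* y)
            (trans (sym (*-assoc _ d x)) (trans (cong (_* x) Δd≡1) (*-identityˡ x))))

        K : State → Dist
        K u = Conditional.Φ (conditional u)

        hull : ∀ u → Hull (R u) (K u)
        hull u = Conditional.hull (conditional u)

        -- The law of total probability: the mixture giving `Θ` is regrouped by the value of `s`.
        Θ≡bind : Θ ≡∑ (Δ at_) · K
        Θ≡bind v = Fubini.unjoin (λ u → Conditional.integral (conditional u) v)
          (IsSum-restrict (λ (_ , i , _) → i) (λ { {_ , _ , refl} {_ , _ , refl} refl → refl })
            (λ i → inj₁ ((s i , i , refl) , refl)) (Θ≡ v))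

      abstract
        -- All components `Δs i` are sent through the one kernel `K` extracted from the lifting, and
        -- linearity reassembles `Θ`. The index set is arbitrary, as in the formulae.
        †-decompose : ∀ {I : Set} {p : I → Carrier} {Δ Δs Θ} → IsWeighting p → Δ ≡∑ p · Δs → (R †ᴰ) Δ Θ →
          Σ[ Θs ∈ (I → Dist) ] (Θ ≡∑ p · Θs × (∀ i → (R †ᴰ) (Δs i) (Θs i)))
        †-decompose {Δ = Δ} {Δs} {Θ} w Δ≡ r =
          (λ i → proj₁ (Θi i))
          , mix-bind {Δ = Δ} {Δs} {Θ} {λ i → proj₁ (Θi i)} {K} (proj₁ w) Δ≡ Θ≡bind (λ i → proj₂ (Θi i))
          , (λ i → †-bind {Θ = proj₁ (Θi i)} hull (proj₂ (Θi i)))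
          where
          open Disintegration r
          Θi : ∀ i → ∃[ Φ ] Φ ≡∑ (Δs i at_) · K
          Θi i = mixture (IsWeighting-at (Δs i)) K

        -- `Θ` and `K s` are both the image of `point s` under the kernel, so they coincide.
        †-point⁻¹ : ∀ {s Θ} → (R †ᴰ) (point s) Θ → Hull (R s) Θ
        †-point⁻¹ {s} {Θ} r =
          subst (Hull (R s)) (mix-unique {Δs = K} {K s} {Θ} (mix-point s K) Θ≡bind) (hull s)
          where open Disintegration r

-- Weak moves: a uniform bound on their length, and their mixtures.

∃-upper-bound : ∀ {n} (f : Fin n → ℕ) → ∃[ N ] (∀ i → f i ℕ.≤ N)
∃-upper-bound {ℕ.zero}  f = 0 , λ ()
∃-upper-bound {ℕ.suc n} f with N , f≤N ← ∃-upper-bound (f ∘ suc) = f zero ℕ.⊔ N , λ where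
  zero    → ℕₚ.m≤m⊔n (f zero) N
  (suc i) → ℕₚ.≤-trans (f≤N i) (ℕₚ.m≤n⊔m (f zero) N)

module Weak (em : ∀ ℓ → ExcludedMiddle ℓ) (ℝ : CompleteOrderedField) (P : PLTS ℝ)
  (divergenceFree : Processes.DivergenceFree ℝ P) where

  open CompleteOrderedField ℝ
  open Processes ℝ P
  open CommutativeRing commutativeRing using (zeroˡ)
  open Sums em ℝ
  open Liftings em ℝ P

  -- A step may idle, so `n` acts as an upper bound on the number of proper steps; see
  -- `steps-weaken`.
  Steps : ℕ → Dist → Dist → Set₁
  Steps ℕ.zero    Δ Θ = Lift (lsuc 0ℓ) (Δ ≡ Θ)
  Steps (ℕ.suc n) Δ Θ = ∃[ Φ ] (Δ —[ τ ]→̂ᴰ Φ × Steps n Φ Θ)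

  Hatτ : State → Dist → Set
  Hatτ s Φ = s —[ τ ]→̂ Φ

  Hatτ-refl : ∀ s → Hatτ s (point s)
  Hatτ-refl _ = inj₂ refl

  →̂-refl : ∀ Δ → Δ —[ τ ]→̂ᴰ Δ
  →̂-refl = †-refl {R = Hatτ} Hatτ-refl

  steps-weaken : ∀ {m n Δ Θ} → m ℕ.≤ n → Steps m Δ Θ → Steps n Δ Θ
  steps-weaken {n = ℕ.zero}  ℕ.z≤n       r           = r
  steps-weaken {n = ℕ.suc n} ℕ.z≤n       r           = _ , →̂-refl _ , steps-weaken {n = n} ℕ.z≤n r
  steps-weaken               (ℕ.s≤s m≤n) (Φ , h , r) = Φ , h , steps-weaken m≤n r

  steps⇒ : ∀ n {Δ Θ} → Steps n Δ Θ → Δ =[ τ ]⇒ Θ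
  steps⇒ ℕ.zero    (lift refl)  = ε
  steps⇒ (ℕ.suc n) (_ , h , r) = h ◅ steps⇒ n r

  ⇒steps : ∀ {Δ Θ} → Δ =[ τ ]⇒ Θ → ∃[ n ] Steps n Δ Θ
  ⇒steps ε        = 0 , lift refl
  ⇒steps (h ◅ hs) with n , r ← ⇒steps hs = ℕ.suc n , _ , h , r

  -- A common `n` lets all runs advance in lockstep, with the intermediate distributions mixed at
  -- each stage.
  steps-mix : ∀ n {I : Set} {p : I → Carrier} {Δ Δs Θ Θs} → I ↣ ℕ → IsWeighting p →
    Δ ≡∑ p · Δs → Θ ≡∑ p · Θs → (∀ i → Steps n (Δs i) (Θs i)) → Steps n Δ Θ
  steps-mix ℕ.zero {Δ = Δ} {Δs} {Θ} {Θs} c w Δ≡ Θ≡ r =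
    lift (mix-unique {Δs = Θs} {Δ} {Θ}
      (mix-cong {Δs = Δs} {Δ} {Θs} (λ i → inj₂ (Level.lower (r i))) Δ≡) Θ≡)
  steps-mix (ℕ.suc n) {Δ = Δ} {Δs} {Θ} {Θs} c w Δ≡ Θ≡ r
    with Φ , Φ≡ ← mixture w (λ i → proj₁ (r i)) =
    Φ , †-mix {Δs = Δs} {Φ} {λ i → proj₁ (r i)} c w Δ≡ Φ≡ (λ i → proj₁ (proj₂ (r i)))
    , steps-mix n {Δs = λ i → proj₁ (r i)} {Θ} {Θs} c w Φ≡ Θ≡ (λ i → proj₂ (proj₂ (r i)))

  steps-decompose : ∀ n {I : Set} {p : I → Carrier} {Δ Δs Θ} → IsWeighting p →
    Δ ≡∑ p · Δs → Steps n Δ Θ →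
    Σ[ Θs ∈ (I → Dist) ] (Θ ≡∑ p · Θs × (∀ i → Steps n (Δs i) (Θs i)))
  steps-decompose ℕ.zero {Δs = Δs} w Δ≡ (lift refl) = Δs , Δ≡ , λ _ → lift refl
  steps-decompose (ℕ.suc n) {Δs = Δs} w Δ≡ (Φ , h , r)
    with Φs , Φ≡ , hs ← †-decompose {R = Hatτ} Hatτ-refl {Δs = Δs} w Δ≡ h
    with Θs , Θ≡ , rs ← steps-decompose n {Δs = Φs} w Φ≡ r =
    Θs , Θ≡ , λ i → Φs i , hs i , rs i

  infix 4 _⊲_

  _⊲_ : State → State → Set
  u ⊲ s = ∃[ Δ ] (s —[ τ ]→ Δ × u ∈⌈ Δ ⌉)

  -- An inaccessible state has an inaccessible successor. Deciding the Σ-type of these successors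
  -- yields a witness, and iterating the choice produces a divergence.
  ⊲-wellFounded : WellFounded _⊲_
  ⊲-wellFounded s₀ with dec (Acc _⊲_ s₀)
  ... | yes a = a
  ... | no ¬a = contradiction
    ( proj₁ ∘ chain , (λ i → proj₁ (proj₂ (next (chain i))))
    , (λ i → proj₂ (proj₂ (next (chain i))))) divergenceFree
    where
    NonAcc : Set
    NonAcc = ∃[ s ] ¬ Acc _⊲_ s
    next : (x : NonAcc) → Σ[ y ∈ NonAcc ] (proj₁ y ⊲ proj₁ x)
    next (s , ¬as) with dec (∃[ u ] (u ⊲ s × ¬ Acc _⊲_ u))
    ... | yes (u , u⊲s , ¬au) = (u , ¬au) , u⊲s
    ... | no h = contradiction (acc λ {u} u⊲s → decidable-stable (dec _) (λ ¬au → h (u , u⊲s , ¬au))) ¬as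
    chain : ℕ → NonAcc
    chain ℕ.zero    = s₀ , ¬a
    chain (ℕ.suc i) = proj₁ (next (chain i))

  StepsBound : State → ℕ → Set₁
  StepsBound s N = ∀ k {Θ} → Steps k (point s) Θ → Steps N (point s) Θ

  -- Any τ-step that is delayed by idling can be performed first instead.
  steps-bound-acc : ∀ s → Acc _⊲_ s → ∃ (StepsBound s)
  steps-bound-acc s (acc below) = ℕ.suc B , bound
    where
    successor-bound : ∀ u → ∃[ N ] (u ⊲ s → StepsBound u N)
    successor-bound u with dec (u ⊲ s)
    ... | yes u⊲s with N , b ← steps-bound-acc u (below u⊲s) = N , λ _ → b
    -- The default 0 lets the maximum `B` range over all states.
    ... | no  u⋪s = 0 , λ u⊲s → contradiction u⊲s u⋪s

    B : ℕ
    B = proj₁ (∃-upper-bound (proj₁ ∘ successor-bound))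

    below-bound : ∀ {u} → u ⊲ s → StepsBound u B
    below-bound {u} u⊲s k r =
      steps-weaken (proj₂ (∃-upper-bound (proj₁ ∘ successor-bound)) u)
        (proj₂ (successor-bound u) u⊲s k r)

    after-step : ∀ k {Φ Θ} → s —[ τ ]→ Φ → Steps k Φ Θ → Steps B Φ Θ
    after-step k {Φ} {Θ} h r
      with Θs , Θ≡ , rs ← steps-decompose k {Δs = point} (IsWeighting-at Φ) (mix-points Φ) r =
      steps-mix B {Δs = point} {Θ} {Ψ} countable-Fin (IsWeighting-at Φ) (mix-points Φ)
        (mix-cong {Δs = Θs} {Θ} {Ψ} agree Θ≡) bounded
      where
      -- No bound is known for runs from states outside the support of `Φ`; these are replaced by
      -- idling, which their weight 0 hides in the mixture.
      Ψ : State → Dist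
      Ψ u with dec (u ∈⌈ Φ ⌉)
      ... | yes _ = Θs u
      ... | no  _ = point u
      agree : ∀ u → Φ at u ≡ 0# ⊎ Θs u ≡ Ψ u
      agree u with dec (u ∈⌈ Φ ⌉)
      ... | yes _  = inj₂ refl
      ... | no u∉ = inj₁ (∉⌈⌉ Φ u∉)
      bounded : ∀ u → Steps B (point u) (Ψ u)
      bounded u with dec (u ∈⌈ Φ ⌉)
      ... | yes u∈ = below-bound (Φ , h , u∈) k (rs u)
      ... | no _   = steps-weaken ℕ.z≤n (lift refl)

    -- The successor pays for the first proper step, after which `B` steps are enough. Components
    -- that idle first fall under the induction on `k`.
    bound : StepsBound s (ℕ.suc B)
    bound ℕ.zero    r = steps-weaken ℕ.z≤n r
    bound (ℕ.suc k) {Θ} (Φ , h , r) =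
      steps-mix (ℕ.suc B) {Δs = λ _ → point s} {Θ} {proj₁ split-r} countable isWeighting
        (mix-const isWeighting (point s)) (proj₁ (proj₂ split-r))
        (λ i → from-s (related i) (proj₂ (proj₂ split-r) i))
      where
      open Hull (†-point⁻¹ {R = Hatτ} Hatτ-refl h)
      split-r : Σ[ Ξs ∈ (I → Dist) ] (Θ ≡∑ p · Ξs × (∀ i → Steps k (Θs i) (Ξs i)))
      split-r = steps-decompose k {Δs = Θs} isWeighting Θ≡ r
      from-s : ∀ {Ψ Ξ} → s —[ τ ]→̂ Ψ → Steps k Ψ Ξ → Steps (ℕ.suc B) (point s) Ξ
      from-s (inj₁ h′)   r′ = _ , †-point (inj₁ h′) , after-step k h′ r′
      from-s (inj₂ refl) r′ = bound k r′

  -- There are finitely many states, so their bounds have a maximum; a run from `Δ` is a mixture of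
  -- runs from its states.
  ∃-steps-bound : ∃[ N ] (∀ {Δ Θ} → Δ =[ τ ]⇒ Θ → Steps N Δ Θ)
  ∃-steps-bound = N , λ {Δ} {Θ} hs → bounded (proj₁ (⇒steps hs)) {Δ} {Θ} (proj₂ (⇒steps hs))
    where
    pointwise : ∀ s → ∃ (StepsBound s)
    pointwise s = steps-bound-acc s (⊲-wellFounded s)
    N : ℕ
    N = proj₁ (∃-upper-bound (proj₁ ∘ pointwise))
    bounded : ∀ k {Δ Θ} → Steps k Δ Θ → Steps N Δ Θ
    bounded k {Δ} {Θ} r
      with Θs , Θ≡ , rs ← steps-decompose k {Δs = point} (IsWeighting-at Δ) (mix-points Δ) r =
      steps-mix N {Δs = point} {Θ} {Θs} countable-Fin (IsWeighting-at Δ) (mix-points Δ) Θ≡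
        (λ s → steps-weaken (proj₂ (∃-upper-bound (proj₁ ∘ pointwise)) s) (proj₂ (pointwise s) k (rs s)))

  module _ {I : Set} {p : I → Carrier} (c : I ↣ ℕ) (w : IsWeighting p) where

    abstract
      -- The uniform bound pads all runs to one length, so that `steps-mix` applies.
      ⇒-mix : ∀ {Δ Δs Θ Θs} → Δ ≡∑ p · Δs → Θ ≡∑ p · Θs →
        (∀ i → Δs i =[ τ ]⇒ Θs i) → Δ =[ τ ]⇒ Θ
      ⇒-mix {Δ} {Δs} {Θ} {Θs} Δ≡ Θ≡ hs with N , bound ← ∃-steps-bound =
        steps⇒ N (steps-mix N {Δs = Δs} {Θ} {Θs} c w Δ≡ Θ≡ (λ i → bound (hs i)))

      move-mix : ∀ m a {Δ Δs Θ Θs} → Δ ≡∑ p · Δs → Θ ≡∑ p · Θs →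
        (∀ i → move m (Δs i) a (Θs i)) → move m Δ a Θ
      move-mix strong a {Δ} {Δs} {Θ} {Θs} Δ≡ Θ≡ hs = †-mix {Δs = Δs} {Θ} {Θs} c w Δ≡ Θ≡ hs
      move-mix weak τ {Δ} {Δs} {Θ} {Θs} Δ≡ Θ≡ hs = ⇒-mix {Δ} {Δs} {Θ} {Θs} Δ≡ Θ≡ hs
      move-mix weak (act a) {Δ} {Δs} {Θ} {Θs} Δ≡ Θ≡ hs
        with Φ , Φ≡ ← mixture w (λ i → proj₁ (hs i))
           | Ψ , Ψ≡ ← mixture w (λ i → proj₁ (proj₂ (hs i))) =
        Φ , Ψ
        , ⇒-mix {Δ} {Δs} {Φ} {λ i → proj₁ (hs i)} Δ≡ Φ≡ (λ i → proj₁ (proj₂ (proj₂ (hs i))))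
        , †-mix {Δs = λ i → proj₁ (hs i)} {Ψ} {λ i → proj₁ (proj₂ (hs i))} c w Φ≡ Ψ≡
            (λ i → proj₁ (proj₂ (proj₂ (proj₂ (hs i)))))
        , ⇒-mix {Ψ} {λ i → proj₁ (proj₂ (hs i))} {Θ} {Θs} Ψ≡ Θ≡
            (λ i → proj₂ (proj₂ (proj₂ (proj₂ (hs i)))))

  -- `related` speaks of every index, even of weight 0, so the index set is the support itself.
  -- Membership goes through `⌊_⌋` to have at most one proof, which makes `proj₁` injective.
  hull-support : ∀ {C Θ} → (∀ u → u ∈⌈ Θ ⌉ → C (point u)) → Hull C Θ
  hull-support {C} {Θ} c = record
    { I = Support ; countable = countable-Σ countable-Fin countable-fibre
    ; p = λ x → Θ at proj₁ x
    ; isWeighting = (λ x → at-nonneg Θ (proj₁ x)) , IsSum-restrict proj₁ proj₁-injective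
        (λ u → support u id) (proj₂ (IsWeighting-at Θ))
    ; Θs = λ x → point (proj₁ x)
    ; related = λ (u , u∈) → c u (∈⌊⌋⁻ {Q = _∈⌈ Θ ⌉} u∈)
    ; Θ≡ = λ v → IsSum-restrict proj₁ proj₁-injective
        (λ u → support u (λ Θ≡0 → trans (cong (_* point u at v) Θ≡0) (zeroˡ _))) (mix-points Θ v) }
    where
    Support : Set
    Support = Σ[ u ∈ State ] u ∈ ⌊ _∈⌈ Θ ⌉ ⌋
    countable-fibre : ∀ u → T (⌊ _∈⌈ Θ ⌉ ⌋ u) ↣ ℕ
    countable-fibre u = mk↣ {to = λ _ → 0} (λ _ → T-irrelevant _ _)
    proj₁-injective : {x y : Support} → proj₁ x ≡ proj₁ y → x ≡ y
    proj₁-injective {u , u∈} {.u , u∈′} refl = cong (u ,_) (T-irrelevant u∈ u∈′)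
    support : ∀ u {x} → (Θ at u ≡ 0# → x ≡ 0#) →
      (∃[ y ] proj₁ {B = λ u → u ∈ ⌊ _∈⌈ Θ ⌉ ⌋} y ≡ u) ⊎ x ≡ 0#
    support u h with dec (u ∈⌈ Θ ⌉)
    ... | yes u∈ = inj₁ ((u , ∈⌊⌋⁺ {Q = _∈⌈ Θ ⌉} u∈) , refl)
    ... | no  u∉ = inj₂ (h (∉⌈⌉ Θ u∉))

  step-move : ∀ m {s a Δ} → s —[ a ]→ Δ → move m (point s) a Δ
  step-move strong h         = †-point h
  step-move weak {a = τ}     h = †-point (inj₁ h) ◅ ε
  step-move weak {a = act a} h = _ , _ , ε , †-point h , ε

  -- Answering moves along a lifted simulation.

  -- At `weak` these are the forward simulations; simulations between states become instances
  -- through `⌜_⌝`, so that one development covers all the cases.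
  IsSimulationᴰ : Semantics → (State → Dist → Set) → Set₁
  IsSimulationᴰ m R = ∀ {s Φ} → R s Φ → ∀ a {Δ} → s —[ a ]→ Δ →
    ∃[ Θ ] (move m Φ a Θ × (R †ᴰ) Δ Θ)

  -- Adds the pairs that `†-decompose` asks for.
  _⁼ : (State → Dist → Set) → State → Dist → Set
  (R ⁼) s Φ = R s Φ ⊎ Φ ≡ point s

  ⁼-refl : ∀ {R} s → (R ⁼) s (point s)
  ⁼-refl s = inj₂ refl

  ⁼-simulation : ∀ m {R} → IsSimulationᴰ m R → IsSimulationᴰ m (R ⁼)
  ⁼-simulation m {R} sim (inj₁ r) a h with Θ , Φ⇒Θ , r′ ← sim r a h = Θ , Φ⇒Θ , †-mono inj₁ r′
  ⁼-simulation m {R} sim (inj₂ refl) a {Δ} h = Δ , step-move m h , †-refl {R = R ⁼} (⁼-refl {R}) Δ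

  module _ {R : State → Dist → Set} (R-refl : ∀ s → R s (point s)) where

    -- The step decomposes `Δ` into points and thereby `Θ` into members of hulls. Answers are found
    -- for the constituents of each hull and then mixed twice, inside each component and across the
    -- components. `S` covers plain as well as idling steps.
    †-respond : ∀ m a {S : State → Dist → Set} →
      (∀ {s Φ Δ} → R s Φ → S s Δ → ∃[ Θ ] (move m Φ a Θ × (R †ᴰ) Δ Θ)) →
      ∀ {Δ Δ′ Θ} → (R †ᴰ) Δ Θ → (S †ᴰ) Δ Δ′ → ∃[ Θ′ ] (move m Θ a Θ′ × (R †ᴰ) Δ′ Θ′)
    †-respond m a {S} respond {Δ} {Δ′} {Θ} r h =
      proj₁ Θ′
      , move-mix countable isWeighting m a {Θ} {Θ₁} {proj₁ Θ′} {λ i → proj₁ (local i)}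
          Θ≡Θ₁ (proj₂ Θ′) (λ i → proj₁ (proj₂ (local i)))
      , †-mix {Δs = Δ′s} {proj₁ Θ′} {λ i → proj₁ (local i)} countable isWeighting
          Θ≡ (proj₂ Θ′) (λ i → proj₂ (proj₂ (local i)))
      where
      open _†ᴰ h renaming (Θs to Δ′s)
      decomposed : Σ[ Θ₁ ∈ (I → Dist) ] (Θ ≡∑ p · Θ₁ × (∀ i → (R †ᴰ) (point (s i)) (Θ₁ i)))
      decomposed = †-decompose R-refl {Δs = point ∘ s} isWeighting Δ≡ r
      Θ₁ : I → Dist
      Θ₁ = proj₁ decomposed
      Θ≡Θ₁ : Θ ≡∑ p · Θ₁
      Θ≡Θ₁ = proj₁ (proj₂ decomposed)
      local : ∀ i → ∃[ Ξ ] (move m (Θ₁ i) a Ξ × (R †ᴰ) (Δ′s i) Ξ)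
      local i = proj₁ Ξ
        , move-mix J.countable J.isWeighting m a {Θ₁ i} {J.Θs} {proj₁ Ξ} {λ j → proj₁ (match j)}
            J.Θ≡ (proj₂ Ξ) (λ j → proj₁ (proj₂ (match j)))
        , †-mix {Δs = λ _ → Δ′s i} {proj₁ Ξ} {λ j → proj₁ (match j)} J.countable J.isWeighting
            (mix-const J.isWeighting (Δ′s i)) (proj₂ Ξ) (λ j → proj₂ (proj₂ (match j)))
        where
        module J = Hull (†-point⁻¹ R-refl (proj₂ (proj₂ decomposed) i))
        match : ∀ j → ∃[ Ξ ] (move m (J.Θs j) a Ξ × (R †ᴰ) (Δ′s i) Ξ)
        match j = respond (J.related j) (related i)
        Ξ : ∃[ Ξ ] Ξ ≡∑ J.p · (λ j → proj₁ (match j))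
        Ξ = mixture J.isWeighting (λ j → proj₁ (match j))
      Θ′ : ∃[ Θ′ ] Θ′ ≡∑ p · (λ i → proj₁ (local i))
      Θ′ = mixture isWeighting (λ i → proj₁ (local i))

    module _ (sim : IsSimulationᴰ weak R) where

      †-⇒ : ∀ {Δ Δ′ Θ} → (R †ᴰ) Δ Θ → Δ =[ τ ]⇒ Δ′ → ∃[ Θ′ ] (Θ =[ τ ]⇒ Θ′ × (R †ᴰ) Δ′ Θ′)
      †-⇒ r ε = _ , ε , r
      †-⇒ r (h ◅ hs)
        with Θ₁ , Θ⇒Θ₁ , r₁ ← †-respond weak τ
               (λ { r₀ (inj₁ h₀) → sim r₀ τ h₀ ; r₀ (inj₂ refl) → _ , ε , †-point r₀ }) r h
        with Θ₂ , Θ₁⇒Θ₂ , r₂ ← †-⇒ r₁ hs = Θ₂ , Θ⇒Θ₁ ◅◅ Θ₁⇒Θ₂ , r₂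

    †-move : ∀ m → IsSimulationᴰ m R → ∀ a {Δ Δ′ Θ} → (R †ᴰ) Δ Θ → move m Δ a Δ′ →
      ∃[ Θ′ ] (move m Θ a Θ′ × (R †ᴰ) Δ′ Θ′)
    †-move strong sim a r h = †-respond strong a (λ r₀ h₀ → sim r₀ a h₀) r h
    †-move weak sim τ r hs = †-⇒ sim r hs
    †-move weak sim (act a) r (Δ₁ , Δ₂ , hs , h , hs′)
      with Θ₁ , Θ⇒Θ₁ , r₁ ← †-⇒ sim r hs
      with Θ₂ , (Ψ , Ξ , Θ₁⇒Ψ , Ψ→Ξ , Ξ⇒Θ₂) , r₂ ←
             †-respond weak (act a) (λ r₀ h₀ → sim r₀ (act a) h₀) r₁ h
      with Θ₃ , Θ₂⇒Θ₃ , r₃ ← †-⇒ sim r₂ hs′ =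
      Θ₃ , (Ψ , Ξ , Θ⇒Θ₁ ◅◅ Θ₁⇒Ψ , Ψ→Ξ , Ξ⇒Θ₂ ◅◅ Θ₂⇒Θ₃) , r₃

-- Transfer of formulae along a relation on distributions.

module Soundness (em : ∀ ℓ → ExcludedMiddle ℓ) (ℝ : CompleteOrderedField) (P : PLTS ℝ) where

  open Processes ℝ P
  open Sums em ℝ using (dec; ⌊_⌋; ∈⌊⌋⁺; ∈⌊⌋⁻)

  record Transfer {ℓ} (L : Logic) (_⊴_ : Dist → Dist → Set ℓ) : Set (ℓ ⊔ lsuc 0ℓ) where
    field
      diamond   : ∀ {Δ Θ a Δ′} → Δ ⊴ Θ → move (semantics L) Δ a Δ′ →
                  ∃[ Θ′ ] (move (semantics L) Θ a Θ′ × Δ′ ⊴ Θ′)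
      decompose : ∀ {I : Set} {p : I → _} {Δ Θ} (Δs : I → Dist) → IsWeighting p → Δ ≡∑ p · Δs → Δ ⊴ Θ →
                  Σ[ Θs ∈ (I → Dist) ] (Θ ≡∑ p · Θs × (∀ i → Δs i ⊴ Θs i))
      symmetric : HasNegationAndBox L → ∀ {Δ Θ} → Δ ⊴ Θ → Θ ⊴ Δ
      down      : HasDown L → ∀ {Δ Θ t} → Δ ⊴ Θ → t ∈⌈ Θ ⌉ → ∃[ s ] (s ∈⌈ Δ ⌉ × point s ⊴ point t)
      refuse    : HasRef L → ∀ {Δ Δ′ Θ} A → Δ ⊴ Θ → Δ =[ τ ]⇒ Δ′ → Δ′ —[ A ]↛ᴰ →
                  ∃[ Θ′ ] (Θ =[ τ ]⇒ Θ′ × Θ′ —[ A ]↛ᴰ)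

  module _ {ℓ} {L : Logic} {_⊴_ : Dist → Dist → Set ℓ} (transfer : Transfer L _⊴_) where
    open Transfer transfer

    -- Odd parity exchanges the two sets but keeps the direction of the relation, because the case
    -- of `¬′` reverses that direction by symmetry.
    Preserves : Parity → 𝒫 Dist → 𝒫 Dist → Set ℓ
    Preserves 0ℙ V W = ∀ {Δ Θ} → Δ ⊴ Θ → Δ ∈ V → Θ ∈ W
    Preserves 1ℙ V W = ∀ {Δ Θ} → Δ ⊴ Θ → Δ ∈ W → Θ ∈ V

    PreservesEnv : Formula → Env → Env → Set ℓ
    PreservesEnv φ ρ ρ′ = ∀ X q → Occurs X q φ → Preserves q (ρ X) (ρ′ X)

    preserves-¬ : ∀ {φ ρ ρ′} → PreservesEnv (¬′ φ) ρ ρ′ → PreservesEnv φ ρ′ ρ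
    preserves-¬ e X 0ℙ = e X 1ℙ
    preserves-¬ e X 1ℙ = e X 0ℙ

    preserves-update : ∀ {φ ρ ρ′ V V′} X → ¬ Occurs X 1ℙ φ → Preserves 0ℙ V V′ →
      (∀ Y q → Y ≢ X × Occurs Y q φ → Preserves q (ρ Y) (ρ′ Y)) →
      PreservesEnv φ (ρ [ X ↦ V ]) (ρ′ [ X ↦ V′ ])
    preserves-update X positive V⟶V′ e Y q occurs
      -- `does (Y ≟ X)` computes to this Boolean, so matching on it evaluates both updated
      -- environments.
      with Y ℕ.≡ᵇ X | ℕₚ.≡ᵇ⇒≡ Y X | ℕₚ.≡⇒≡ᵇ Y X
    ... | false | _   | ≢ = e Y q (≢ , occurs)
    ... | true  | Y≡X | _ with refl ← Y≡X tt | q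
    ... | 0ℙ = V⟶V′
    ... | 1ℙ = contradiction occurs positive

    ⟦⟧-transfer : ∀ φ {ρ ρ′ Δ Θ} → φ ∈𝓛μ L → PreservesEnv φ ρ ρ′ → Δ ⊴ Θ →
      ⟦ φ ⟧ (semantics L) ρ Δ → ⟦ φ ⟧ (semantics L) ρ′ Θ
    ⟦⟧-transfer (⋀ I φ) φ∈ e r h i = ⟦⟧-transfer (φ i) (φ∈ i) (λ X q o → e X q (i , o)) r (h i)
    ⟦⟧-transfer (⋁ I φ) φ∈ e r (i , h) = i , ⟦⟧-transfer (φ i) (φ∈ i) (λ X q o → e X q (i , o)) r h
    ⟦⟧-transfer (⨁ I φ) φ∈ e r (p , w , Δs , Δ≡ , h) with Θs , Θ≡ , rs ← decompose Δs w Δ≡ r =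
      p , w , Θs , Θ≡ , λ i → ⟦⟧-transfer (φ i) (φ∈ i) (λ X q o → e X q (i , o)) (rs i) (h i)
    ⟦⟧-transfer (⨁[ p ∣ w ] φ) φ∈ e r (Δs , Δ≡ , h) with Θs , Θ≡ , rs ← decompose Δs w Δ≡ r =
      Θs , Θ≡ , λ i → ⟦⟧-transfer (φ i) (φ∈ i) (λ X q o → e X q (i , o)) (rs i) (h i)
    ⟦⟧-transfer (¬′ φ) (neg , φ∈) e r h h′ =
      h (⟦⟧-transfer φ φ∈ (preserves-¬ {φ} e) (symmetric neg r) h′)
    ⟦⟧-transfer (⟨ a ⟩ φ) φ∈ e r (Δ′ , m , h) with Θ′ , m′ , r′ ← diamond r m =
      Θ′ , m′ , ⟦⟧-transfer φ φ∈ e r′ h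
    ⟦⟧-transfer ([ a ] φ) (neg , φ∈) e r h Θ′ m with Δ′ , m′ , r′ ← diamond (symmetric neg r) m =
      ⟦⟧-transfer φ φ∈ e (symmetric neg r′) (h Δ′ m′)
    ⟦⟧-transfer (↓ φ) (hasDown , φ∈) e r h t t∈ with s , s∈ , r′ ← down hasDown r t∈ =
      ⟦⟧-transfer φ φ∈ e r′ (h s s∈)
    ⟦⟧-transfer (var X) φ∈ e r (lift h) = lift (e X 0ℙ (refl , refl) r h)
    ⟦⟧-transfer (μ X φ) {ρ} {ρ′} (positive , φ∈) e r h V V-closed =
      ∈⌊⌋⁻ {Q = Below} (h ⌊ Below ⌋ below-closed) r
      where
      -- The largest set that the relation carries into `V`; it is a prefixed point on the side of
      -- `ρ`.
      Below : Dist → Set ℓ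
      Below Ψ = ∀ {Ξ} → Ψ ⊴ Ξ → Ξ ∈ V
      below-closed : ∀ {Ψ} → ⟦ φ ⟧ (semantics L) (ρ [ X ↦ ⌊ Below ⌋ ]) Ψ → Ψ ∈ ⌊ Below ⌋
      below-closed h′ = ∈⌊⌋⁺ {Q = Below} (λ r′ → V-closed (⟦⟧-transfer φ φ∈
        (preserves-update {φ} {ρ} {ρ′} X positive (λ r″ Ψ∈ → ∈⌊⌋⁻ {Q = Below} Ψ∈ r″) e) r′ h′))
    ⟦⟧-transfer (ν X φ) {ρ} {ρ′} (positive , φ∈) e r (V , V-closed , Δ∈V) =
      ⌊ Above ⌋ , above-closed , ∈⌊⌋⁺ {Q = Above} (_ , Δ∈V , r)
      where
      -- Dually, the image of `V` under the relation is a postfixed point on the side of `ρ′`.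
      Above : Dist → Set ℓ
      Above Ξ = ∃[ Ψ ] (Ψ ∈ V × Ψ ⊴ Ξ)
      above-closed : ∀ {Ξ} → Ξ ∈ ⌊ Above ⌋ → ⟦ φ ⟧ (semantics L) (ρ′ [ X ↦ ⌊ Above ⌋ ]) Ξ
      above-closed Ξ∈ with Ψ , Ψ∈V , r′ ← ∈⌊⌋⁻ {Q = Above} Ξ∈ = ⟦⟧-transfer φ φ∈
        (preserves-update {φ} {ρ} {ρ′} X positive (λ r″ Ψ∈ → ∈⌊⌋⁺ {Q = Above} (_ , Ψ∈ , r″)) e)
        r′ (V-closed Ψ∈V)
    ⟦⟧-transfer (ref A) φ∈ e r (Δ′ , Δ⇒Δ′ , refuses) = refuse φ∈ A r Δ⇒Δ′ refuses

    ⊑μ-transfer : ∀ {Δ Θ} → Δ ⊴ Θ → Δ ⊑μ[ L ] Θ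
    ⊑μ-transfer r φ φ∈ closed ρ = ⟦⟧-transfer φ φ∈ (λ X q o → contradiction o (closed X q)) r

  withoutFixpoints⇒closed : ∀ φ → WithoutFixpoints φ → Closed φ
  withoutFixpoints⇒closed (⋀ I φ) w X q (i , o) = withoutFixpoints⇒closed (φ i) (w i) X q o
  withoutFixpoints⇒closed (⋁ I φ) w X q (i , o) = withoutFixpoints⇒closed (φ i) (w i) X q o
  withoutFixpoints⇒closed (⨁ I φ) w X q (i , o) = withoutFixpoints⇒closed (φ i) (w i) X q o
  withoutFixpoints⇒closed (⨁[ _ ∣ _ ] φ) w X q (i , o) = withoutFixpoints⇒closed (φ i) (w i) X q o
  withoutFixpoints⇒closed (¬′ φ) w X q = withoutFixpoints⇒closed φ w X (q ⁻¹)
  withoutFixpoints⇒closed (⟨ a ⟩ φ) = withoutFixpoints⇒closed φ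
  withoutFixpoints⇒closed ([ a ] φ) = withoutFixpoints⇒closed φ
  withoutFixpoints⇒closed (↓ φ) = withoutFixpoints⇒closed φ
  withoutFixpoints⇒closed (ref A) w X q ()

  ⊑μ⇒⊑ : ∀ L {Δ Θ} → Δ ⊑μ[ L ] Θ → Δ ⊑[ L ] Θ
  ⊑μ⇒⊑ L h φ (w , φ∈) = h φ φ∈ (withoutFixpoints⇒closed φ w)

  -- With equality as the relation, transfer compares two environments at a single distribution.
  ≡-transfer : ∀ L → Transfer L _≡_
  ≡-transfer L = record
    { diamond   = λ { refl m → _ , m , refl }
    ; decompose = λ { Δs _ Δ≡ refl → Δs , Δ≡ , λ _ → refl }
    ; symmetric = λ _ → sym
    ; down      = λ { _ refl t∈ → _ , t∈ , refl }
    ; refuse    = λ { _ A refl Δ⇒Δ′ refuses → _ , Δ⇒Δ′ , refuses } }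

  ⟦⟧-env-irrelevant : ∀ L {φ} → φ ∈𝓛 L → ∀ ρ ρ′ {Δ} → ⟦ φ ⟧ (semantics L) ρ Δ → ⟦ φ ⟧ (semantics L) ρ′ Δ
  ⟦⟧-env-irrelevant L {φ} (w , φ∈) ρ ρ′ = ⟦⟧-transfer (≡-transfer L) φ φ∈
    (λ X q o → contradiction o (withoutFixpoints⇒closed φ w X q)) refl

-- From simulations to logical inclusion.

module Characterisation (em : ∀ ℓ → ExcludedMiddle ℓ) (ℝ : CompleteOrderedField) (P : PLTS ℝ)
  (divergenceFree : Processes.DivergenceFree ℝ P) where

  open CompleteOrderedField ℝ
  open Processes ℝ P
  open Sums em ℝ
  open Liftings em ℝ P
  open Weak em ℝ P divergenceFree
  open Soundness em ℝ P

  PointsOnly : (State → Dist → Set) → Set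
  PointsOnly R = ∀ {s Φ} → R s Φ → ∃[ t ] Φ ≡ point t

  RespectsRefusals : (State → Dist → Set) → Set₁
  RespectsRefusals R = ∀ {s Φ} → R s Φ → ∀ A → s —[ A ]↛ → ∃[ Φ′ ] (Φ =[ τ ]⇒ Φ′ × Φ′ —[ A ]↛ᴰ)

  -- A state `t` in the support of `Θ` comes from a component of nonzero weight. That component is a
  -- point, hence `point t`, and its left-hand state lies in the support of `Δ`.
  †-down : ∀ {R} → PointsOnly R → ∀ {Δ Θ t} → (R †ᴰ) Δ Θ → t ∈⌈ Θ ⌉ →
    ∃[ s ] (s ∈⌈ Δ ⌉ × (R †ᴰ) (point s) (point t))
  †-down {R} pts {Δ} {Θ} {t} r t∈ with i , p≢0 , Θi≢0 ← ∈⌈⌉-mix {Δs = _†ᴰ.Θs r} {Θ} (_†ᴰ.Θ≡ r) t∈ =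
    s i , ∈⌈⌉-mix⁺ {Δ = Δ} {point ∘ s} (proj₁ isWeighting) Δ≡ p≢0
            (λ ≡0 → 0≢1 (trans (sym ≡0) (point-at (s i))))
    , †-point (Rpoint (pts (related i)))
    where
    open _†ᴰ r
    Rpoint : ∃[ u ] Θs i ≡ point u → R (s i) (point t)
    Rpoint (u , Θi≡) with dec (t ≡ u)
    ... | yes refl = subst (R (s i)) Θi≡ (related i)
    ... | no  t≢u  = contradiction (trans (cong (_at t) Θi≡) (point-at-≢ t≢u)) Θi≢0

  †-refuse : ∀ {R} → RespectsRefusals R → ∀ {Δ Θ} A → (R †ᴰ) Δ Θ → Δ —[ A ]↛ᴰ →
    ∃[ Θ′ ] (Θ =[ τ ]⇒ Θ′ × Θ′ —[ A ]↛ᴰ)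
  †-refuse {R} refusals {Δ} {Θ} A r Δ↛ =
    proj₁ Θ′
    , ⇒-mix countable isWeighting {Θ} {Θs} {proj₁ Θ′} {λ i → proj₁ (local i)} Θ≡ (proj₂ Θ′)
        (λ i → proj₁ (proj₂ (local i)))
    , refuses
    where
    open _†ᴰ r
    local : ∀ i → ∃[ Ψ ] (Θs i =[ τ ]⇒ Ψ × (p i ≢ 0# → Ψ —[ A ]↛ᴰ))
    local i with dec (p i ≡ 0#)
    -- An index of weight 0 adds no state to the mixture, so it may idle and owes no refusal; its
    -- `s i` need not lie in the support of `Δ`.
    ... | yes p≡0 = Θs i , ε , λ p≢0 → contradiction p≡0 p≢0
    ... | no  p≢0 with Ψ , Θi⇒Ψ , Ψ↛ ← refusals (related i) A (Δ↛ (s i)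
                         (∈⌈⌉-mix⁺ {Δ = Δ} {point ∘ s} (proj₁ isWeighting) Δ≡ p≢0
                           (λ ≡0 → 0≢1 (trans (sym ≡0) (point-at (s i)))))) = Ψ , Θi⇒Ψ , λ _ → Ψ↛
    Θ′ : ∃[ Θ′ ] Θ′ ≡∑ p · (λ i → proj₁ (local i))
    Θ′ = mixture isWeighting (λ i → proj₁ (local i))
    refuses : proj₁ Θ′ —[ A ]↛ᴰ
    refuses u u∈ with i , p≢0 , Ψ≢0 ← ∈⌈⌉-mix {Δs = λ i → proj₁ (local i)} {proj₁ Θ′} (proj₂ Θ′) u∈ =
      proj₂ (proj₂ (local i)) p≢0 u (at-nonneg (proj₁ (local i)) u , Ψ≢0 ∘ sym)

  point-refuses : ∀ {s A} → s —[ A ]↛ → point s —[ A ]↛ᴰ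
  point-refuses {s} s↛ u u∈ with refl ← ∈⌈⌉-point s u u∈ = s↛

  ⁼-refusals : ∀ {R} → RespectsRefusals R → RespectsRefusals (R ⁼)
  ⁼-refusals refusals (inj₁ r)    A s↛ = refusals r A s↛
  ⁼-refusals refusals (inj₂ refl) A s↛ = _ , ε , point-refuses s↛

  ⁼-pointsOnly : ∀ {R} → PointsOnly R → PointsOnly (R ⁼)
  ⁼-pointsOnly pts (inj₁ r)    = pts r
  ⁼-pointsOnly pts (inj₂ Φ≡) = _ , Φ≡

  -- The relation transferred is the lifting of `R ⁼`. The hypotheses after `sim` are guarded by
  -- features of `L` and hold vacuously for logics lacking them. `ref` always speaks of weak moves,
  -- whence the equation with `weak`.
  simulation⇒⊑μ : ∀ L {R} → IsSimulationᴰ (semantics L) R →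
    (HasNegationAndBox L → ∀ {Δ Θ} → ((R ⁼) †ᴰ) Δ Θ → ((R ⁼) †ᴰ) Θ Δ) →
    (HasDown L → PointsOnly R) →
    (HasRef L → semantics L ≡ weak × RespectsRefusals R) →
    ∀ {s Φ} → R s Φ → point s ⊑μ[ L ] Φ
  simulation⇒⊑μ L {R} sim symmetric pts refusals {s} {Φ} r = ⊑μ-transfer transfer (†-point (inj₁ r))
    where
    sim⁼ : IsSimulationᴰ (semantics L) (R ⁼)
    sim⁼ = ⁼-simulation (semantics L) sim
    refuse : HasRef L → ∀ {Δ Δ′ Θ} A → ((R ⁼) †ᴰ) Δ Θ → Δ =[ τ ]⇒ Δ′ → Δ′ —[ A ]↛ᴰ →
      ∃[ Θ′ ] (Θ =[ τ ]⇒ Θ′ × Θ′ —[ A ]↛ᴰ)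
    refuse hasRef A r Δ⇒Δ′ Δ′↛ with semantics≡ , ref-R ← refusals hasRef
      with Θ₁ , Θ⇒Θ₁ , r₁ ← †-⇒ (⁼-refl {R}) (subst (λ m → IsSimulationᴰ m (R ⁼)) semantics≡ sim⁼) r Δ⇒Δ′
      with Θ₂ , Θ₁⇒Θ₂ , Θ₂↛ ← †-refuse (⁼-refusals ref-R) A r₁ Δ′↛ =
      Θ₂ , Θ⇒Θ₁ ◅◅ Θ₁⇒Θ₂ , Θ₂↛
    transfer : Transfer L ((R ⁼) †ᴰ)
    transfer = record
      { diamond   = †-move (⁼-refl {R}) (semantics L) sim⁼ _
      ; decompose = λ Δs w Δ≡ r′ → †-decompose (⁼-refl {R}) {Δs = Δs} w Δ≡ r′
      ; symmetric = symmetric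
      ; down      = λ hasDown → †-down (⁼-pointsOnly {R} (pts hasDown))
      ; refuse    = refuse }

  ⌜_⌝ : (State → State → Set) → State → Dist → Set
  ⌜ R ⌝ s Φ = ∃[ t ] (R s t × Φ ≡ point t)

  ⌜⌝-pointsOnly : ∀ {R} → PointsOnly ⌜ R ⌝
  ⌜⌝-pointsOnly (t , _ , Φ≡) = t , Φ≡

  †ˢ⇒†ᴰ : ∀ {R Δ Θ} → (R †ˢ) Δ Θ → (⌜ R ⌝ †ᴰ) Δ Θ
  †ˢ⇒†ᴰ r = record { _†ˢ r ; Θs = point ∘ t ; related = λ i → t i , related i , refl }
    where open _†ˢ r using (t; related)

  †ᴰ⇒†ˢ : ∀ {R Δ Θ} → (⌜ R ⌝ †ᴰ) Δ Θ → (R †ˢ) Δ Θ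
  †ᴰ⇒†ˢ {Θ = Θ} r = record
    { _†ᴰ r
    ; t       = λ i → proj₁ (related i)
    ; related = λ i → proj₁ (proj₂ (related i))
    ; Θ≡      = mix-cong {Δs = Θs} {Θ} {λ i → point (proj₁ (related i))}
                  (λ i → inj₂ (proj₂ (proj₂ (related i)))) Θ≡ }
    where open _†ᴰ r using (Θs; related; Θ≡)

  ⌜⌝-simulation : ∀ m {R} → IsSimulation m R → IsSimulationᴰ m ⌜ R ⌝
  ⌜⌝-simulation m sim (t , r , refl) a h with Θ , t⇒Θ , r′ ← sim r a h = Θ , t⇒Θ , †ˢ⇒†ᴰ r′

  -- All distributions on the right are points, so the two families of states can be exchanged.
  ⌜⌝⁼-symmetric : ∀ {R : State → State → Set} → (∀ {s t} → R s t → R t s) →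
    ∀ {Δ Θ} → ((⌜ R ⌝ ⁼) †ᴰ) Δ Θ → ((⌜ R ⌝ ⁼) †ᴰ) Θ Δ
  ⌜⌝⁼-symmetric {R} R-sym {Δ} {Θ} r = record
    { _†ᴰ r
    ; s       = λ i → proj₁ (target i)
    ; Θs      = λ i → point (s i)
    ; related = λ i → proj₂ (proj₂ (target i))
    ; Δ≡      = mix-cong {Δs = Θs} {Θ} {λ i → point (proj₁ (target i))}
                  (λ i → inj₂ (proj₁ (proj₂ (target i)))) Θ≡
    ; Θ≡      = Δ≡ }
    where
    open _†ᴰ r using (I; s; Θs; related; Δ≡; Θ≡)
    target′ : ∀ {s Φ} → (⌜ R ⌝ ⁼) s Φ → ∃[ t ] (Φ ≡ point t × (⌜ R ⌝ ⁼) t (point s))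
    target′ (inj₁ (t , Rst , Φ≡)) = t , Φ≡ , inj₁ (_ , R-sym Rst , refl)
    target′ (inj₂ Φ≡)             = _ , Φ≡ , inj₂ refl
    target : ∀ i → ∃[ t ] (Θs i ≡ point t × (⌜ R ⌝ ⁼) t (point (s i)))
    target i = target′ (related i)

  -- A bisimulation may fail to be symmetric, whereas transfer in the presence of negation calls for
  -- a symmetric simulation.
  SymmetricClosure : (State → State → Set) → State → State → Set
  SymmetricClosure R s t = R s t ⊎ R t s

  bisimulation⇒simulation : ∀ m {R} → IsBisimulation m R → IsSimulation m (SymmetricClosure R)
  bisimulation⇒simulation m (sim , sim⁻¹) (inj₁ r) a h with Θ , t⇒Θ , r′ ← sim r a h =
    Θ , t⇒Θ , record { _†ˢ r′ ; related = λ i → inj₁ (_†ˢ.related r′ i) }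
  bisimulation⇒simulation m (sim , sim⁻¹) (inj₂ r) a h with Θ , t⇒Θ , r′ ← sim⁻¹ r a h =
    Θ , t⇒Θ , record { _†ˢ r′ ; related = λ i → inj₂ (_†ˢ.related r′ i) }

  -- From logical inclusion to simulations.

  module Completeness (L : Logic) where

    m : Semantics
    m = semantics L

    -- Formulae without fixpoints contain no variables here, so one fixed environment represents
    -- all.
    ρ₀ : Env
    ρ₀ _ _ = false

    distinguish : ∀ {Δ Φ} → ¬ Δ ⊑[ L ] Φ →
      ∃[ φ ] (φ ∈𝓛 L × ⟦ φ ⟧ m ρ₀ Δ × ¬ ⟦ φ ⟧ m ρ₀ Φ)
    distinguish {Δ} {Φ} ⋢ with dec (∃[ φ ] (φ ∈𝓛 L × ⟦ φ ⟧ m ρ₀ Δ × ¬ ⟦ φ ⟧ m ρ₀ Φ))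
    ... | yes d = d
    ... | no ¬d = contradiction
      (λ φ φ∈ ρ Δ⊨ → ⟦⟧-env-irrelevant L {φ} φ∈ ρ₀ ρ (decidable-stable (dec _)
        (λ Φ⊭ → ¬d (φ , φ∈ , ⟦⟧-env-irrelevant L {φ} φ∈ ρ ρ₀ Δ⊨ , Φ⊭)))) ⋢

    -- As the index set of a conjunction this must lie in `Set`, whereas `_⊑[_]_` lies in `Set₁`;
    -- `⌊_⌋` bridges the gap.
    NotAbove : State → Set
    NotAbove s = Σ[ Φ ∈ Dist ] Φ ∈ ⌊ (λ Φ → ¬ point s ⊑[ L ] Φ) ⌋

    distinguishing : ∀ s (x : NotAbove s) →
      ∃[ φ ] (φ ∈𝓛 L × ⟦ φ ⟧ m ρ₀ (point s) × ¬ ⟦ φ ⟧ m ρ₀ (proj₁ x))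
    distinguishing s (Φ , Φ∈) = distinguish (∈⌊⌋⁻ {Q = λ Φ → ¬ point s ⊑[ L ] Φ} Φ∈)

    characteristic : State → Formula
    characteristic s = ⋀ (NotAbove s) (λ x → proj₁ (distinguishing s x))

    characteristic∈𝓛 : ∀ s → characteristic s ∈𝓛 L
    characteristic∈𝓛 s = (λ x → proj₁ (proj₁ (proj₂ (distinguishing s x))))
                       , (λ x → proj₂ (proj₁ (proj₂ (distinguishing s x))))

    characteristic-point : ∀ s → ⟦ characteristic s ⟧ m ρ₀ (point s)
    characteristic-point s x = proj₁ (proj₂ (proj₂ (distinguishing s x)))

    characteristic⇒⊑ : ∀ {s Φ} → ⟦ characteristic s ⟧ m ρ₀ Φ → point s ⊑[ L ] Φ
    characteristic⇒⊑ {s} {Φ} h = decidable-stable (dec _) (λ ⋢ →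
      let x = Φ , ∈⌊⌋⁺ {Q = λ Φ → ¬ point s ⊑[ L ] Φ} ⋢
      in proj₂ (proj₂ (proj₂ (distinguishing s x))) (h x))

    -- The given transition of `s`, split into points, witnesses the formula at `point s`. Taking
    -- `ψ` as a parameter serves both `characteristic` and its `↓`.
    ⊑-step : ∀ {s Φ a Δ} (ψ : State → Formula) → (∀ u → ψ u ∈𝓛 L) → (∀ u → ⟦ ψ u ⟧ m ρ₀ (point u)) →
      point s ⊑[ L ] Φ → s —[ a ]→ Δ →
      ∃[ Θ ] (move m Φ a Θ ×
        (Σ[ Θs ∈ (State → Dist) ] (Θ ≡∑ (Δ at_) · Θs × (∀ u → ⟦ ψ u ⟧ m ρ₀ (Θs u)))))
    ⊑-step {a = a} {Δ} ψ ψ∈ ψ-point s⊑Φ h = s⊑Φ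
      (⟨ a ⟩ ⨁[ (Δ at_) ∣ IsWeighting-at Δ ] ψ)
      ((λ u → proj₁ (ψ∈ u)) , (λ u → proj₂ (ψ∈ u))) ρ₀
      (Δ , step-move m h , point , mix-points Δ , ψ-point)

    Above : State → Dist → Set
    Above s Φ = Φ ∈ ⌊ (λ Φ → point s ⊑[ L ] Φ) ⌋

    ⊑⇒Above : ∀ {s Φ} → point s ⊑[ L ] Φ → Above s Φ
    ⊑⇒Above {s} = ∈⌊⌋⁺ {Q = λ Φ → point s ⊑[ L ] Φ}

    Above⇒⊑ : ∀ {s Φ} → Above s Φ → point s ⊑[ L ] Φ
    Above⇒⊑ {s} = ∈⌊⌋⁻ {Q = λ Φ → point s ⊑[ L ] Φ}

    Above-simulation : IsSimulationᴰ m Above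
    Above-simulation s⊑Φ a h
      with Θ , Φ⇒Θ , Θs , Θ≡ , hs ←
             ⊑-step characteristic characteristic∈𝓛 characteristic-point (Above⇒⊑ s⊑Φ) h =
      Θ , Φ⇒Θ , †-bind {Θ = Θ} {Θs} (λ u → hull-single (⊑⇒Above (characteristic⇒⊑ (hs u)))) Θ≡

    Aboveˢ : State → State → Set
    Aboveˢ s t = Above s (point t)

    -- Because of `↓`, each state in the support of `Θs u` is individually above `u`, so `Θs u` is a
    -- mixture of points above `u`, as a lifting between states demands.
    Aboveˢ-simulation : HasDown L → IsSimulation m Aboveˢ
    Aboveˢ-simulation hasDown s⊑t a h
      with Θ , t⇒Θ , Θs , Θ≡ , hs ← ⊑-step (λ u → ↓ characteristic u)
             (λ u → proj₁ (characteristic∈𝓛 u) , hasDown , proj₂ (characteristic∈𝓛 u))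
             (λ u v v∈ → subst (λ v → ⟦ characteristic u ⟧ m ρ₀ (point v)) (sym (∈⌈⌉-point u v v∈))
               (characteristic-point u))
             (Above⇒⊑ s⊑t) h =
      Θ , t⇒Θ , †ᴰ⇒†ˢ (†-bind {Θ = Θ} {Θs} (λ u → hull-support (λ v v∈ →
        v , ⊑⇒Above (characteristic⇒⊑ (hs u v v∈)) , refl)) Θ≡)

    ⊑-symmetric : HasNegationAndBox L → ∀ {Δ Θ} → Δ ⊑[ L ] Θ → Θ ⊑[ L ] Δ
    ⊑-symmetric neg Δ⊑Θ φ (w , φ∈) ρ Θ⊨ = decidable-stable (dec _) (λ Δ⊭ →
      Δ⊑Θ (¬′ φ) (w , neg , φ∈) ρ Δ⊭ Θ⊨)

    Aboveˢ-bisimulation : HasNegationAndBox L → HasDown L → IsBisimulation m Aboveˢ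
    Aboveˢ-bisimulation neg hasDown = Aboveˢ-simulation hasDown , sim⁻¹
      where
      sim⁻¹ : IsSimulation m (flip Aboveˢ)
      sim⁻¹ t⊑s a h
        with Θ , t⇒Θ , r ← Aboveˢ-simulation hasDown (⊑⇒Above (⊑-symmetric neg (Above⇒⊑ t⊑s))) a h =
        Θ , t⇒Θ , record
          { _†ˢ r ; related = λ i → ⊑⇒Above (⊑-symmetric neg (Above⇒⊑ (_†ˢ.related r i))) }

    Above-refusals : HasRef L → RespectsRefusals Above
    Above-refusals hasRef s⊑Φ A s↛ = Above⇒⊑ s⊑Φ (ref A) (tt , hasRef) ρ₀ (_ , ε , point-refuses s↛)

    similar : HasDown L → ∀ {s t} → point s ⊑[ L ] point t → ∃[ R ] (IsSimulation m R × R s t)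
    similar hasDown h = Aboveˢ , (λ {_} {_} → Aboveˢ-simulation hasDown) , ⊑⇒Above h

    bisimilar : HasNegationAndBox L → HasDown L →
      ∀ {s t} → point s ⊑[ L ] point t → ∃[ R ] (IsBisimulation m R × R s t)
    bisimilar neg hasDown h = Aboveˢ , Aboveˢ-bisimulation neg hasDown , ⊑⇒Above h

    simulatedᴰ : ∀ {s Φ} → point s ⊑[ L ] Φ → ∃[ R ] (IsSimulationᴰ m R × R s Φ)
    simulatedᴰ h = Above , (λ {_} {_} → Above-simulation) , ⊑⇒Above h

    failureSimulatedᴰ : HasRef L → ∀ {s Φ} → point s ⊑[ L ] Φ →
      ∃[ R ] ((IsSimulationᴰ m R × RespectsRefusals R) × R s Φ)
    failureSimulatedᴰ hasRef h =
      Above , ((λ {_} {_} → Above-simulation) , (λ {_} {_} → Above-refusals hasRef)) , ⊑⇒Above h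

  -- Assembling the six characterisations.

  cycle : ∀ L {Δ Φ} {B : Set₁} → (B → Δ ⊑μ[ L ] Φ) → (Δ ⊑[ L ] Φ → B) →
    (B ⇔ Δ ⊑μ[ L ] Φ) × (Δ ⊑μ[ L ] Φ ⇔ Δ ⊑[ L ] Φ)
  cycle L sound complete =
    mk⇔ sound (λ h → complete (⊑μ⇒⊑ L h)) ,
    mk⇔ (⊑μ⇒⊑ L) (λ h → sound (complete h))

  bisimulation-sound : ∀ L → ¬ HasRef L → ∀ {R} → IsBisimulation (semantics L) R →
    ∀ {s t} → R s t → point s ⊑μ[ L ] point t
  bisimulation-sound L noRef {R} bisim r = simulation⇒⊑μ L
    (⌜⌝-simulation (semantics L) (bisimulation⇒simulation (semantics L) bisim))
    (λ _ → ⌜⌝⁼-symmetric Sum.swap) (λ _ → ⌜⌝-pointsOnly {SymmetricClosure R})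
    (λ hasRef → contradiction hasRef noRef)
    (_ , inj₁ r , refl)

  simulation-sound : ∀ L → ¬ HasNegationAndBox L → ¬ HasRef L → ∀ {R} → IsSimulation (semantics L) R →
    ∀ {s t} → R s t → point s ⊑μ[ L ] point t
  simulation-sound L noNeg noRef {R} sim r = simulation⇒⊑μ L
    (⌜⌝-simulation (semantics L) sim)
    (λ neg → contradiction neg noNeg) (λ _ → ⌜⌝-pointsOnly {R}) (λ hasRef → contradiction hasRef noRef)
    (_ , r , refl)

theorem4 : (∀ ℓ → ExcludedMiddle ℓ) →
    (ℝ : CompleteOrderedField) (P : PLTS ℝ) →
    let open Processes ℝ P in
    DivergenceFree →
    (s t : State) (Θ : Dist) →
    ((s ∼ t ⇔ point s ≡μ[ L∼ ] point t) ×
    (point s ≡μ[ L∼ ] point t ⇔ point s ≡[ L∼ ] point t)) ×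
    ((s ≺ t ⇔ point s ⊑μ[ L≺ ] point t) ×
    (point s ⊑μ[ L≺ ] point t ⇔ point s ⊑[ L≺ ] point t)) ×
    ((s ≈ t ⇔ point s ≡μ[ L≈ ] point t) ×
    (point s ≡μ[ L≈ ] point t ⇔ point s ≡[ L≈ ] point t)) ×
    ((s ≾ t ⇔ point s ⊑μ[ L≾ ] point t) ×
    (point s ⊑μ[ L≾ ] point t ⇔ point s ⊑[ L≾ ] point t)) ×
    ((s ◁S Θ ⇔ point s ⊑μ[ L◁S ] Θ) ×
    (point s ⊑μ[ L◁S ] Θ ⇔ point s ⊑[ L◁S ] Θ)) ×
    ((s ◁FS Θ ⇔ point s ⊑μ[ L◁FS ] Θ) ×
    (point s ⊑μ[ L◁FS ] Θ ⇔ point s ⊑[ L◁FS ] Θ))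
theorem4 em ℝ P divergenceFree s t Θ =
    cycle L∼ (λ (R , bisim , r) → bisimulation-sound L∼ (λ ()) bisim r)
      (Completeness.bisimilar L∼ tt tt)
  , cycle L≺ (λ (R , sim , r) → simulation-sound L≺ (λ ()) (λ ()) sim r)
      (Completeness.similar L≺ tt)
  , cycle L≈ (λ (R , bisim , r) → bisimulation-sound L≈ (λ ()) bisim r)
      (Completeness.bisimilar L≈ tt tt)
  , cycle L≾ (λ (R , sim , r) → simulation-sound L≾ (λ ()) (λ ()) sim r)
      (Completeness.similar L≾ tt)
  , cycle L◁S (λ (R , sim , r) → simulation⇒⊑μ L◁S sim (λ ()) (λ ()) (λ ()) r)
      (Completeness.simulatedᴰ L◁S)
  , cycle L◁FS
      (λ (R , (sim , refusals) , r) → simulation⇒⊑μ L◁FS sim (λ ()) (λ ()) (λ _ → refl , refusals) r)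
      (Completeness.failureSimulatedᴰ L◁FS tt)
  where
  open Processes ℝ P
  open Characterisation em ℝ P divergenceFree
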